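{- There is a positive absolute constant $k_4$ such that for every integer $c\ge 3$, written as $c=q_1^{a_1}\cdots q_\omega^{a_\omega}$ with $q_i$ distinct primes and $a_i\ge 1$, $$G_c^{2/\varphi(c)}>k_4\prod_{i=1}^{\omega} q_i^{\,2a_i-1-\frac{2}{\varphi(c)}E_c(q_i)}\left(\frac{q_i-1}{2}\right)^2.$$
   Context: For a positive integer $n$, $R(n)$ denotes the product of the distinct primes dividing $n$. $\varphi$ is Euler's totient function. For $c\ge3$, $G_c$ is the product of $R(abc)$ over all pairs of positive integers $(a,b)$ with $a+b=c$, $a<b$, $\gcd(a,b)=1$ (there are $\varphi(c)/2$ such pairs), so $G_c^{2/\varphi(c)}$ is the geometric mean of these radicals. For $c$ with distinct prime factors $q_1,\dots,q_\omega$ and real $x\ne0$, $E_c(x)=\sum_{S\subseteq\{1,\dots,\omega\}}(-1)^{|S|}\lfloor c/(x\prod_{j\in S}q_j)\rfloor$. -}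

module Defs where

open import Data.Bool.Base using (if_then_else_)
open import Data.Fin.Base using (Fin; zero; suc)
open import Data.Fin.Subset using (Subset; inside; outside; ∣_∣)
open import Data.Integer.Base as ℤ using (ℤ; +_; -[1+_]; 0ℤ; -1ℤ)
open import Data.List.Base as List using (List; []; _∷_; _++_; filter; length; upTo)
open import Data.List.Membership.Propositional.Properties using (∈-filter⁺; ∈-map⁺; ∈-upTo⁺)
open import Data.List.Relation.Unary.All as All using ()
open import Data.List.Relation.Unary.All.Properties using (all-filter) renaming (map⁺ to All-map⁺)
open import Data.List.Relation.Unary.Any using (here; there)
open import Data.List.Membership.Propositional using (_∈_)
open import Data.Nat.Base as ℕ using (ℕ; zero; suc; NonZero; _∸_; s≤s; z≤n)
open import Data.Nat.Coprimality using (coprime?; 1-coprimeTo)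
open import Data.Nat.Divisibility using (_∣?_)
open import Data.Nat.ListAction using (product)
open import Data.Nat.ListAction.Properties using (product≢0)
import Data.Nat.Properties as ℕ
open import Data.Nat.Primality using (Prime; prime?; prime⇒nonZero; prime⇒nonTrivial)
open import Data.Product.Base using (_×_; _,_; proj₁)
open import Data.Rational.Base as ℚ using (ℚ; ↥_; ↧ₙ_; 1/_; Positive)
open import Data.Rational.Properties using (pos⇒nonZero; 1/pos⇒pos; pos*pos⇒pos; normalize-pos)
import Algebra.Definitions.RawSemiring ℚ.+-*-rawSemiring as ℚPow
open import Data.Vec.Base as Vec using ()
import Data.Vec.Functional as Vector
open import Function.Base using (_∘_)
open import Function.Definitions using (Injective)
open import Relation.Binary.PropositionalEquality using (_≡_; subst; sym)
open import Relation.Nullary.Decidable using (_×-dec_)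

private
  variable
    n : ℕ

-- `m √ r` is the positive real number r^(1/m). These numbers are closed
-- under multiplication and rational powers, and two of them are compared
-- exactly by clearing the roots. A constant k > 0 bounding such numbers
-- from below may be sought here rather than in the reals, since every
-- positive real lies above some positive rational.
-- Representations are not unique (2 √ 4 and 1 √ 2 denote the same number).

infix 9 _√_

record Radical : Set where
  constructor _√_
  field
    index              : ℕ
    radicand           : ℚ
    {{index-nonZero}}  : NonZero index
    {{radicand-pos}}   : Positive radicand

^-pos : ∀ r .{{_ : Positive r}} k → Positive (r ℚPow.^ k)
^-pos r zero    = _
^-pos r (suc k) = pos*pos⇒pos r (r ℚPow.^ k) {{^-pos r k}}

infixr 8 _^ℤ_

_^ℤ_ : (r : ℚ) .{{_ : Positive r}} → ℤ → ℚ
r ^ℤ (+ k)    = r ℚPow.^ k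
r ^ℤ -[1+ k ] = (1/ r) {{pos⇒nonZero r}} ℚPow.^ suc k

^ℤ-pos : ∀ r .{{_ : Positive r}} z → Positive (r ^ℤ z)
^ℤ-pos r (+ k)    = ^-pos r k
^ℤ-pos r -[1+ k ] = ^-pos ((1/ r) {{pos⇒nonZero r}}) {{1/pos⇒pos r}} (suc k)

/-pos : ∀ m n .{{_ : NonZero m}} .{{_ : NonZero n}} → Positive (+ m ℚ./ n)
/-pos m n = normalize-pos m n

infixl 7 _*_
infixr 8 _^_
infix  4 _<_ _>_

_*_ : Radical → Radical → Radical
(m √ r) * (n √ s) = _√_ (m ℕ.* n) (r ℚPow.^ n ℚ.* s ℚPow.^ m)
  {{ℕ.m*n≢0 m n}}
  {{pos*pos⇒pos (r ℚPow.^ n) {{^-pos r n}} (s ℚPow.^ m) {{^-pos s m}}}}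

_^_ : Radical → ℚ → Radical
(m √ r) ^ e@record{} = _√_ (m ℕ.* ↧ₙ e) (r ^ℤ ↥ e) {{ℕ.m*n≢0 m (↧ₙ e)}} {{^ℤ-pos r (↥ e)}}

-- r^(1/m) < s^(1/n) exactly when r^n < s^m.
_<_ : Radical → Radical → Set
(m √ r) < (n √ s) = r ℚPow.^ n ℚ.< s ℚPow.^ m

_>_ : Radical → Radical → Set
x > y = y < x

frac : (m n : ℕ) .{{_ : NonZero m}} .{{_ : NonZero n}} → Radical
frac m n = _√_ 1 (+ m ℚ./ n) {{_}} {{/-pos m n}}

nat : (m : ℕ) .{{_ : NonZero m}} → Radical
nat m = frac m 1

∏ : (Fin n → Radical) → Radical
∏ = Vector.foldr _*_ (nat 1)

[1⋯_] : ℕ → List ℕ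
[1⋯ n ] = List.map suc (upTo n)

primeDivisors : ℕ → List ℕ
primeDivisors n = filter (λ p → prime? p ×-dec p ∣? n) [1⋯ n ]

R : ℕ → ℕ
R n = product (primeDivisors n)

φ : ℕ → ℕ
φ n = length (filter (λ k → coprime? k n) [1⋯ n ])

-- The pairs (a , b) of positive integers with a + b = c, a < b and
-- gcd(a, b) = 1. Truncated subtraction gives no spurious pair, as
-- a < c ∸ a forces a < c.
coprimePairs : ℕ → List (ℕ × ℕ)
coprimePairs c =
  filter (λ (a , b) → a ℕ.<? b ×-dec coprime? a b)
         (List.map (λ a → a , c ∸ a) [1⋯ c ])

G : ℕ → ℕ
G c = product (List.map (λ (a , b) → R (a ℕ.* b ℕ.* c)) (coprimePairs c))

R≢0 : ∀ n → NonZero (R n)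
R≢0 n = product≢0 (All.map (prime⇒nonZero ∘ proj₁) (all-filter _ [1⋯ n ]))

G≢0 : ∀ c → NonZero (G c)
G≢0 c = product≢0 (All-map⁺ (All.universal (λ (a , b) → R≢0 (a ℕ.* b ℕ.* c)) (coprimePairs c)))

φ≢0 : ∀ n .{{_ : NonZero n}} → NonZero (φ n)
φ≢0 n@(suc _) = ∈⇒length≢0 (∈-filter⁺ (λ k → coprime? k n) (∈-map⁺ suc (∈-upTo⁺ (s≤s z≤n))) (1-coprimeTo n))
  where
  ∈⇒length≢0 : ∀ {x : ℕ} {xs} → x ∈ xs → NonZero (length xs)
  ∈⇒length≢0 (here _)  = _
  ∈⇒length≢0 (there _) = _

subsets : ∀ n → List (Subset n)
subsets zero    = Vec.[] ∷ []
subsets (suc n) = List.map (outside Vec.∷_) (subsets n) ++ List.map (inside Vec.∷_) (subsets n)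

∏ℕ : (Fin n → ℕ) → ℕ
∏ℕ = Vector.foldr ℕ._*_ 1

∏ℕ≢0 : (f : Fin n → ℕ) → (∀ i → NonZero (f i)) → NonZero (∏ℕ f)
∏ℕ≢0 {zero}  f f≢0 = _
∏ℕ≢0 {suc n} f f≢0 =
  ℕ.m*n≢0 _ _ {{f≢0 zero}} {{∏ℕ≢0 (f ∘ suc) (f≢0 ∘ suc)}}

record Factorisation (c : ℕ) : Set where
  field
    ω          : ℕ
    q          : Fin ω → ℕ
    a          : Fin ω → ℕ
    q-prime    : ∀ i → Prime (q i)
    q-distinct : Injective _≡_ _≡_ q
    a≥1        : ∀ i → a i ℕ.≥ 1
    c≡∏q^a     : c ≡ ∏ℕ (λ i → q i ℕ.^ a i)

  instance
    q≢0 : ∀ {i} → NonZero (q i)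
    q≢0 {i} = prime⇒nonZero (q-prime i)

    q∸1≢0 : ∀ {i} → NonZero (q i ∸ 1)
    q∸1≢0 {i} = ℕ.>-nonZero (ℕ.m<n⇒0<n∸m (ℕ.nonTrivial⇒n>1 (q i) {{prime⇒nonTrivial (q-prime i)}}))

    φ[c]≢0 : NonZero (φ c)
    φ[c]≢0 = φ≢0 c {{c≢0}}
      where
      c≢0 : NonZero c
      c≢0 = subst NonZero (sym c≡∏q^a) (∏ℕ≢0 _ (λ i → ℕ.m^n≢0 (q i) (a i) {{q≢0 {i}}}))

  ∏[_]q : Subset ω → ℕ
  ∏[ S ]q = ∏ℕ (λ j → if Vec.lookup S j then q j else 1)

  ∏[]q≢0 : ∀ S → NonZero ∏[ S ]q
  ∏[]q≢0 S = ∏ℕ≢0 _ factor≢0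
    where
    factor≢0 : ∀ j → NonZero (if Vec.lookup S j then q j else 1)
    factor≢0 j with Vec.lookup S j
    ... | inside  = q≢0 {j}
    ... | outside = _

  -- Natural-number division is the floor of the quotient; x is a positive
  -- integer because E is only evaluated at the primes q i.
  E : (x : ℕ) .{{x≢0 : NonZero x}} → ℤ
  E x {{x≢0}} = List.foldr ℤ._+_ 0ℤ (List.map term (subsets ω))
    where
    term : Subset ω → ℤ
    term S = -1ℤ ℤ.^ ∣ S ∣ ℤ.* + ((c ℕ./ (x ℕ.* ∏[ S ]q)) {{ℕ.m*n≢0 x ∏[ S ]q {{x≢0}} {{∏[]q≢0 S}}}})

-- Let R = R(c), let L be the set of residues k ≤ c coprime to c, and let Ψ = ∏ qᵢ^(aᵢ−1) (qᵢ − 1).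
-- The two entries of the coprime pairs run through L, and R is multiplicative on coprime arguments,
-- so G² ≥ R^φ (∏_{k∈L} R(k))².
--
-- Write k = d² r with r squarefree, so that R(k) ≥ k / d². Since at most c / d² of the k ≤ c are
-- multiples of d² and Σ log d / d² converges, the product of all the d² is at most 2^(8c), whereas
-- ∏_{k∈L} k ≥ φ! ≥ (φ / 4)^φ. Hence ∏_{k∈L} R(k) ≥ (φ / 4)^φ / 2^(8c).
--
-- The loss 2^(8c) is absorbed by the factors 1/2 in (qᵢ − 1) / 2. By the sieve of Eratosthenes φ ≥ Ψ,
-- and consecutive odd primes differ by at least 2, which gives (c / Ψ)² = ∏ (qᵢ / (qᵢ − 1))² ≤ 4 (1 + 2 ω)
-- and so 8c ≤ φ (ω + 256).
--
-- By the same sieve E(x) counts the m ≤ c / x coprime to c. It is therefore nonnegative, and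
-- the factors qᵢ^(−2 E(qᵢ) / φ) only help.

module Submission where

-- The quotient c / φ is unbounded, so no absolute constant can swallow the loss, which becomes
-- 4^(8c / φ) once `G c ^ 2` is compared with a φ-th power. The bound survives because the
-- right-hand side carries a factor 4^(-ω), while c / φ grows at most like √ω. The gap between odd
-- primes yields just such a bound, and comparing √ω with ω fixes the additive constant 256.
--
-- Both sides are raised to the power φ(c), and dyadic blocks replace log d by an integer, so that
-- the estimates run in ℕ; only the last two parts handle rationals and roots.

-- Products over duplicate-free lists.

module ListProducts where
  open import Data.List.Base using (List; []; _∷_; _++_; map; length)
  open import Data.List.Membership.Propositional using (_∈_)
  open import Data.List.Membership.Propositional.Properties using (∈-∃++; ∈-++⁺ˡ; ∈-++⁺ʳ; ∈-++⁻)
  open import Data.List.Properties using (map-++; length-++; ++-identityʳ)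
  open import Data.List.Relation.Binary.Permutation.Propositional using (_↭_; ↭-trans; ↭-sym; prep)
  open import Data.List.Relation.Binary.Permutation.Propositional.Properties using (shift; ↭-length; map⁺; ∈-resp-↭)
  open import Data.List.Relation.Binary.Subset.Propositional using (_⊆_)
  open import Data.List.Relation.Unary.All using (lookup)
  open import Data.List.Relation.Unary.AllPairs using ([]; _∷_)
  open import Data.List.Relation.Unary.Any using (here; there)
  open import Data.List.Relation.Unary.Unique.Propositional using (Unique)
  open import Data.Nat.Base
  open import Data.Nat.ListAction using (product)
  open import Data.Nat.ListAction.Properties using (product-↭; product-++)
  open import Data.Nat.Properties
  open import Data.Product.Base using (∃-syntax; _,_)
  open import Data.Sum.Base using (inj₁; inj₂)
  open import Relation.Binary.PropositionalEquality
  open import Relation.Nullary.Negation using (contradiction)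

  private variable
    A : Set
    xs ys : List A

  -- Length and product are invariant under permutation, so exhibiting a complement `zs` makes both
  -- monotone under inclusion. Uniqueness ensures that the later elements are still found in `ys`
  -- after `x` is taken out.
  Unique-⊆⇒↭-++ : Unique xs → xs ⊆ ys → ∃[ zs ] (ys ↭ xs ++ zs)
  Unique-⊆⇒↭-++ {xs = []} {ys} [] xs⊆ys = ys , _↭_.refl
  Unique-⊆⇒↭-++ {xs = x ∷ xs} (x∉xs ∷ uniq) xs⊆ys
    with as , bs , refl ← ∈-∃++ (xs⊆ys (here refl)) =
    let zs , p = Unique-⊆⇒↭-++ {ys = as ++ bs} uniq xs⊆as++bs
    in zs , ↭-trans (shift x as bs) (prep x p)
    where
    xs⊆as++bs : xs ⊆ as ++ bs
    xs⊆as++bs {y} y∈xs with ∈-++⁻ as (xs⊆ys (there y∈xs))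
    ... | inj₁ y∈as            = ∈-++⁺ˡ y∈as
    ... | inj₂ (here y≡x)      = contradiction (sym y≡x) (lookup x∉xs y∈xs)
    ... | inj₂ (there y∈bs)    = ∈-++⁺ʳ as y∈bs

  Unique-⊆⊇⇒↭ : Unique xs → Unique ys → xs ⊆ ys → ys ⊆ xs → ys ↭ xs
  Unique-⊆⊇⇒↭ {xs = xs} {ys} uxs uys xs⊆ys ys⊆xs
    with Unique-⊆⇒↭-++ uxs xs⊆ys | Unique-⊆⇒↭-++ uys ys⊆xs
  ... | [] , p     | _      = subst (ys ↭_) (++-identityʳ xs) p
  -- A nonempty complement makes `ys` longer than `xs`, which is at least as long as `ys`.
  ... | z ∷ zs , p | ws , q = contradiction length-ys<length-ys (<-irrefl refl)
    where
    open ≤-Reasoning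
    length-ys<length-ys : length ys < length ys
    length-ys<length-ys = begin-strict
      length ys                     ≤⟨ m≤m+n _ _ ⟩
      length ys + length ws         ≡⟨ length-++ ys ⟨
      length (ys ++ ws)             ≡⟨ ↭-length q ⟨
      length xs                     <⟨ m<m+n _ z<s ⟩
      length xs + length (z ∷ zs)   ≡⟨ length-++ xs ⟨
      length (xs ++ z ∷ zs)         ≡⟨ ↭-length p ⟨
      length ys                     ∎

  Unique-⊆⇒length≤ : Unique xs → xs ⊆ ys → length xs ≤ length ys
  Unique-⊆⇒length≤ {xs = xs} {ys} uniq xs⊆ys with zs , p ← Unique-⊆⇒↭-++ uniq xs⊆ys = begin
    length xs               ≤⟨ m≤m+n _ _ ⟩
    length xs + length zs   ≡⟨ length-++ xs ⟨
    length (xs ++ zs)       ≡⟨ ↭-length p ⟨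
    length ys               ∎
    where open ≤-Reasoning

  module _ (f : A → ℕ) where
    1≤product-map : ∀ xs → (∀ {x} → x ∈ xs → 1 ≤ f x) → 1 ≤ product (map f xs)
    1≤product-map []       1≤f = ≤-refl
    1≤product-map (x ∷ xs) 1≤f = *-mono-≤ (1≤f (here refl)) (1≤product-map xs λ p → 1≤f (there p))

    product-map-++ : ∀ xs ys → product (map f (xs ++ ys)) ≡ product (map f xs) * product (map f ys)
    product-map-++ xs ys = trans (cong product (map-++ f xs ys)) (product-++ (map f xs) (map f ys))

    Unique-⊆⇒product≤ : Unique xs → xs ⊆ ys → (∀ {y} → y ∈ ys → 1 ≤ f y) →
                        product (map f xs) ≤ product (map f ys)
    Unique-⊆⇒product≤ {xs = xs} {ys} uniq xs⊆ys 1≤f with zs , p ← Unique-⊆⇒↭-++ uniq xs⊆ys = begin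
      product (map f xs)                       ≡⟨ *-identityʳ _ ⟨
      product (map f xs) * 1                   ≤⟨ *-monoʳ-≤ (product (map f xs)) (1≤product-map zs λ q → 1≤f (∈-resp-↭ (↭-sym p) (∈-++⁺ʳ xs q))) ⟩
      product (map f xs) * product (map f zs)  ≡⟨ product-map-++ xs zs ⟨
      product (map f (xs ++ zs))               ≡⟨ product-↭ (map⁺ f p) ⟨
      product (map f ys)                       ∎
      where open ≤-Reasoning

  product-map-mono : ∀ (f g : A → ℕ) xs → (∀ {x} → x ∈ xs → f x ≤ g x) →
                     product (map f xs) ≤ product (map g xs)
  product-map-mono f g []       f≤g = ≤-refl
  product-map-mono f g (x ∷ xs) f≤g = *-mono-≤ (f≤g (here refl)) (product-map-mono f g xs λ p → f≤g (there p))

  product-map-* : ∀ (f g : A → ℕ) xs →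
                  product (map (λ x → f x * g x) xs) ≡ product (map f xs) * product (map g xs)
  product-map-* f g []       = refl
  product-map-* f g (x ∷ xs) = trans (cong (f x * g x *_) (product-map-* f g xs)) ([m*n]*[o*p]≡[m*o]*[n*p] (f x) _ _ _)

-- Average size of the square divisors of the integers up to n.

module SquareWeights where
  open import Data.Nat.Base
  open import Data.Nat.Divisibility
  open import Data.Nat.DivMod
  open import Data.Nat.Properties
  open import Algebra.Properties.CommutativeSemigroup +-commutativeSemigroup using (interchange)
  open import Data.Nat.Tactic.RingSolver using (solve-∀)
  open import Data.Bool.Base using (if_then_else_)
  open import Relation.Binary.PropositionalEquality
  open import Relation.Nullary.Decidable using (does; yes; no; Dec; dec-true; dec-false)
  open import Relation.Nullary.Negation using (¬_)

  Σ< : ℕ → (ℕ → ℕ) → ℕ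
  Σ< zero    f = 0
  Σ< (suc n) f = Σ< n f + f n

  Σ<-cong : ∀ n {f g} → (∀ i → f i ≡ g i) → Σ< n f ≡ Σ< n g
  Σ<-cong zero    f≡g = refl
  Σ<-cong (suc n) f≡g = cong₂ _+_ (Σ<-cong n f≡g) (f≡g n)

  Σ<-mono : ∀ n {f g} → (∀ i → f i ≤ g i) → Σ< n f ≤ Σ< n g
  Σ<-mono zero    f≤g = z≤n
  Σ<-mono (suc n) f≤g = +-mono-≤ (Σ<-mono n f≤g) (f≤g n)

  Σ<-const : ∀ n m → Σ< n (λ _ → m) ≡ n * m
  Σ<-const zero    m = refl
  Σ<-const (suc n) m = trans (cong (_+ m) (Σ<-const n m)) (+-comm (n * m) m)

  Σ<-0 : ∀ n → Σ< n (λ _ → 0) ≡ 0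
  Σ<-0 n = trans (Σ<-const n 0) (*-zeroʳ n)

  Σ<-+ : ∀ n (f g : ℕ → ℕ) → Σ< n (λ i → f i + g i) ≡ Σ< n f + Σ< n g
  Σ<-+ zero    f g = refl
  Σ<-+ (suc n) f g = trans (cong (_+ (f n + g n)) (Σ<-+ n f g)) (interchange (Σ< n f) _ _ _)

  Σ<-*ˡ : ∀ n m f → Σ< n (λ i → m * f i) ≡ m * Σ< n f
  Σ<-*ˡ zero    m f = sym (*-zeroʳ m)
  Σ<-*ˡ (suc n) m f = trans (cong (_+ m * f n) (Σ<-*ˡ n m f)) (sym (*-distribˡ-+ m (Σ< n f) (f n)))

  Σ<-comm : ∀ m n (f : ℕ → ℕ → ℕ) → Σ< m (λ i → Σ< n (f i)) ≡ Σ< n (λ j → Σ< m (λ i → f i j))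
  Σ<-comm zero    n f = sym (Σ<-0 n)
  Σ<-comm (suc m) n f = trans (cong (_+ Σ< n (f m)) (Σ<-comm m n f)) (sym (Σ<-+ n _ (f m)))

  f[i]≤Σ< : ∀ n f {i} → i < n → f i ≤ Σ< n f
  f[i]≤Σ< (suc n) f {i} i<1+n with i ≟ n
  ... | yes refl = m≤n+m (f n) (Σ< n f)
  ... | no i≢n   = ≤-trans (f[i]≤Σ< n f (≤∧≢⇒< (s≤s⁻¹ i<1+n) i≢n)) (m≤m+n _ (f n))

  ind : ∀ {P : Set} → Dec P → ℕ
  ind P? = if does P? then 1 else 0

  ind-yes : ∀ {P : Set} (P? : Dec P) → P → ind P? ≡ 1
  ind-yes P? p = cong (if_then 1 else 0) (dec-true P? p)

  ind-no : ∀ {P : Set} (P? : Dec P) → ¬ P → ind P? ≡ 0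
  ind-no P? ¬p = cong (if_then 1 else 0) (dec-false P? ¬p)

  module _ (d : ℕ) .{{_ : NonZero d}} where
    suc-/-∣ : ∀ n → d ∣ suc n → suc n / d ≡ suc (n / d)
    suc-/-∣ n (divides zero ())
    suc-/-∣ n (divides (suc k) eq) = begin
      suc n / d                       ≡⟨ cong (_/ d) eq ⟩
      (d + k * d) / d                 ≡⟨ m*n/n≡m (suc k) d ⟩
      suc k                           ≡⟨ cong suc k≡n/d ⟩
      suc (n / d)                     ∎
      where
      open ≡-Reasoning
      n<[1+k]d : n < suc k * d
      n<[1+k]d = subst (n <_) eq ≤-refl
      kd≤n : k * d ≤ n
      kd≤n = s≤s⁻¹ (subst (k * d <_) (sym eq) (m<n+m (k * d) (>-nonZero⁻¹ d)))
      k≡n/d : k ≡ n / d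
      k≡n/d = ≤-antisym
        (subst (_≤ n / d) (m*n/n≡m k d) (/-monoˡ-≤ d kd≤n))
        (s≤s⁻¹ (m<n*o⇒m/o<n n<[1+k]d))

    suc-/-∤ : ∀ n → d ∤ suc n → suc n / d ≡ n / d
    suc-/-∤ n d∤1+n = ≤-antisym (s≤s⁻¹ (m<n*o⇒m/o<n {n = suc (n / d)} 1+n<)) (/-monoˡ-≤ d (n≤1+n n))
      where
      1+n≤ : suc n ≤ suc (n / d) * d
      1+n≤ = subst (_< suc (n / d) * d) (sym (m≡m%n+[m/n]*n n d)) (+-monoˡ-< (n / d * d) (m%n<n n d))
      1+n< : suc n < suc (n / d) * d
      1+n< = ≤∧≢⇒< 1+n≤ λ eq → d∤1+n (divides (suc (n / d)) eq)

    -- The quotient `n / d` steps up exactly at the multiples of `d`. A constant `g` gives the count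
    -- of multiples of a square; `g = χ (q ∘ suc)` gives the sieve recursion.
    Σ<-multiples : ∀ n (g : ℕ → ℕ) → Σ< n (λ i → ind (d ∣? suc i) * g (suc i)) ≡ Σ< (n / d) (λ i → g (d * suc i))
    Σ<-multiples zero    g = cong (λ k → Σ< k (λ i → g (d * suc i))) (sym (0/n≡0 d))
    Σ<-multiples (suc n) g with d ∣? suc n
    ... | yes d∣1+n = begin
      Σ< n _ + (1 * g (suc n))                    ≡⟨ cong₂ _+_ (Σ<-multiples n g) (trans (*-identityˡ _) (cong g 1+n≡)) ⟩
      Σ< (suc (n / d)) (λ i → g (d * suc i))    ≡⟨ cong (λ k → Σ< k (λ i → g (d * suc i))) (suc-/-∣ n d∣1+n) ⟨
      Σ< (suc n / d) (λ i → g (d * suc i))      ∎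
      where
      open ≡-Reasoning
      1+n≡ : suc n ≡ d * suc (n / d)
      1+n≡ = trans (sym (m*[n/m]≡n d∣1+n)) (cong (d *_) (suc-/-∣ n d∣1+n))
    ... | no d∤1+n = trans (+-identityʳ _) (trans (Σ<-multiples n g)
                       (cong (λ k → Σ< k (λ i → g (d * suc i))) (sym (suc-/-∤ n d∤1+n))))

    Σ<-ind-∣ : ∀ n → Σ< n (λ i → ind (d ∣? suc i)) ≡ n / d
    Σ<-ind-∣ n = begin
      Σ< n (λ i → ind (d ∣? suc i))       ≡⟨ Σ<-cong n (λ i → sym (*-identityʳ _)) ⟩
      Σ< n (λ i → ind (d ∣? suc i) * 1)   ≡⟨ Σ<-multiples n (λ _ → 1) ⟩
      Σ< (n / d) (λ _ → 1)                ≡⟨ Σ<-const (n / d) 1 ⟩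
      n / d * 1                           ≡⟨ *-identityʳ _ ⟩
      n / d                               ∎
      where open ≡-Reasoning

  -- On the dyadic block 2ʲ ≤ d < 2ʲ⁺¹ the integer `j + 1` serves as an upper bound for log₂ d, so
  -- no logarithm appears.
  blockCount : ℕ → ℕ → ℕ
  blockCount j k = Σ< (2 ^ j) (λ i → ind ((2 ^ j + i) ^ 2 ∣? k))

  -- If d² ∣ k and 2ʲ ≤ d < 2ʲ⁺¹ with j < J, the j-th summand makes weight J k ≥ j + 1 ≥ log₂ d.
  weight : ℕ → ℕ → ℕ
  weight J k = Σ< J (λ j → suc j * blockCount j k)

  -- Double counting: each of the 2ʲ values d in the block has d² ≥ 4ʲ, hence at most n / 4ʲ
  -- multiples of d² up to `n`.
  Σ-blockCount : ∀ n j → 2 ^ j * Σ< n (λ i → blockCount j (suc i)) ≤ n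
  Σ-blockCount n j = *-cancelˡ-≤ (2 ^ j) {{m^n≢0 2 j}} (begin
    2^j * (2^j * Σ< n (λ i → blockCount j (suc i)))
      ≡⟨ cong (λ s → 2^j * (2^j * s)) (Σ<-comm n 2^j _) ⟩
    2^j * (2^j * Σ< 2^j (λ i → Σ< n (λ k → ind ((2^j + i) ^ 2 ∣? suc k))))
      ≡⟨ cong (2^j *_) (Σ<-*ˡ 2^j 2^j _) ⟨
    2^j * Σ< 2^j (λ i → 2^j * Σ< n (λ k → ind ((2^j + i) ^ 2 ∣? suc k)))
      ≡⟨ Σ<-*ˡ 2^j 2^j _ ⟨
    Σ< 2^j (λ i → 2^j * (2^j * Σ< n (λ k → ind ((2^j + i) ^ 2 ∣? suc k))))
      ≤⟨ Σ<-mono 2^j term≤n ⟩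
    Σ< 2^j (λ _ → n)
      ≡⟨ Σ<-const 2^j n ⟩
    2^j * n ∎)
    where
    open ≤-Reasoning
    2^j : ℕ
    2^j = 2 ^ j
    term≤n : ∀ i → 2^j * (2^j * Σ< n (λ k → ind ((2^j + i) ^ 2 ∣? suc k))) ≤ n
    term≤n i = begin
      2^j * (2^j * Σ< n (λ k → ind (d ^ 2 ∣? suc k)))  ≡⟨ cong (λ s → 2^j * (2^j * s)) (Σ<-ind-∣ (d ^ 2) n) ⟩
      2^j * (2^j * (n / d ^ 2))                        ≡⟨ *-assoc 2^j 2^j _ ⟨
      2^j * 2^j * (n / d ^ 2)                          ≤⟨ *-monoˡ-≤ _ (*-mono-≤ (m≤m+n 2^j i) (≤-trans (m≤m+n 2^j i) (≤-reflexive (sym (*-identityʳ d))))) ⟩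
      d ^ 2 * (n / d ^ 2)                              ≡⟨ *-comm (d ^ 2) _ ⟩
      n / d ^ 2 * d ^ 2                                ≤⟨ m/n*n≤m n (d ^ 2) ⟩
      n                                                ∎
      where
      d = 2^j + i
      instance
        d≢0 : NonZero d
        d≢0 = >-nonZero (<-≤-trans (m^n>0 2 j) (m≤m+n 2^j i))
        d²≢0 : NonZero (d ^ 2)
        d²≢0 = m^n≢0 d 2

  -- Σⱼ (j + 1) / 2ʲ telescopes, since (j + 1) / 2ʲ = (2 j + 4) / 2ʲ − (2 (j + 1) + 4) / 2ʲ⁺¹.
  Σ-suc*halving : ∀ n (A : ℕ → ℕ) → (∀ j → 2 ^ j * A j ≤ n) → ∀ J → Σ< J (λ j → suc j * A j) ≤ 4 * n
  Σ-suc*halving n A 2^jA≤n J = *-cancelˡ-≤ (2 ^ J) {{m^n≢0 2 J}} (≤-trans (m≤m+n _ _) (telescoped J))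
    where
    open ≤-Reasoning
    telescoped : ∀ J → 2 ^ J * Σ< J (λ j → suc j * A j) + (2 * J + 4) * n ≤ 2 ^ J * (4 * n)
    telescoped zero    = ≤-reflexive (sym (*-identityˡ (4 * n)))
    -- Adding `(2 * J + 2) * n` raises the coefficient `2 * J + 6` to `4 * J + 8`, twice that of the
    -- induction hypothesis, and pays for the new summand on the other side.
    telescoped (suc J) = +-cancelʳ-≤ ((2 * J + 2) * n) _ _ (begin
      2 * t * (S + suc J * A J) + (2 * suc J + 4) * n + (2 * J + 2) * n   ≡⟨ step₁ t S J (A J) n ⟩
      2 * (t * S + (2 * J + 4) * n) + (2 * J + 2) * (t * A J)            ≤⟨ +-mono-≤ (*-monoʳ-≤ 2 (telescoped J)) (*-monoʳ-≤ (2 * J + 2) (2^jA≤n J)) ⟩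
      2 * (t * (4 * n)) + (2 * J + 2) * n                                ≡⟨ cong (_+ (2 * J + 2) * n) (*-assoc 2 t (4 * n)) ⟨
      2 * t * (4 * n) + (2 * J + 2) * n                                  ∎)
      where
      t = 2 ^ J
      S = Σ< J (λ j → suc j * A j)
      step₁ : ∀ t S J a n → 2 * t * (S + suc J * a) + (2 * suc J + 4) * n + (2 * J + 2) * n
                          ≡ 2 * (t * S + (2 * J + 4) * n) + (2 * J + 2) * (t * a)
      step₁ = solve-∀

  -- The bound is uniform in `J`, so `J` may be chosen as large as the range of `k` demands.
  Σ-weight : ∀ n J → Σ< n (λ i → weight J (suc i)) ≤ 4 * n
  Σ-weight n J = begin
    Σ< n (λ i → weight J (suc i))                              ≡⟨ Σ<-comm n J _ ⟩
    Σ< J (λ j → Σ< n (λ i → suc j * blockCount j (suc i)))     ≡⟨ Σ<-cong J (λ j → Σ<-*ˡ n (suc j) _) ⟩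
    Σ< J (λ j → suc j * Σ< n (λ i → blockCount j (suc i)))     ≤⟨ Σ-suc*halving n _ (Σ-blockCount n) J ⟩
    4 * n                                                      ∎
    where open ≤-Reasoning

-- Lower bounds for the radical.

module Radicals where
  open ListProducts
  open SquareWeights
  open import Defs using (R; R≢0; primeDivisors; [1⋯_])
  open import Data.List.Base using (List; []; _∷_; _++_; map; upTo)
  open import Data.List.Membership.Propositional using (_∈_)
  open import Data.List.Membership.Propositional.Properties
    using (∈-map⁺; ∈-map⁻; ∈-filter⁺; ∈-filter⁻; ∈-upTo⁺; ∈-upTo⁻; ∈-∃++; ∈-++⁻)
  open import Data.List.Properties using (map-id; map-++; upTo-∷ʳ)
  open import Data.List.Relation.Binary.Disjoint.Propositional using (Disjoint)
  open import Data.List.Relation.Binary.Permutation.Propositional.Properties using (shift; All-resp-↭)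
  open import Data.List.Relation.Unary.All as All using (All; []; _∷_)
  open import Data.List.Relation.Unary.All.Properties using (¬Any⇒All¬)
  open import Data.List.Relation.Unary.AllPairs as AllPairs using (AllPairs; []; _∷_)
  import Data.List.Relation.Unary.AllPairs.Properties as AllPairs
  open import Data.List.Relation.Unary.Unique.Propositional using (Unique)
  import Data.List.Relation.Unary.Unique.Propositional.Properties as Unique
  open import Data.Nat.Base
  open import Data.Nat.Coprimality using (Coprime)
  open import Data.Nat.Divisibility
  open import Data.Nat.ListAction using (product)
  open import Data.Nat.ListAction.Properties using (product-++; product-↭; ∈⇒∣product)
  open import Data.Nat.Primality
  open import Data.Nat.Primality.Factorisation using (PrimeFactorisation; factorise)
  open import Data.Nat.Properties
  open import Data.List.Membership.DecPropositional _≟_ using (_∈?_)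
  open import Algebra.Properties.CommutativeSemigroup *-commutativeSemigroup using (x∙yz≈y∙xz)
  open import Data.Nat.Tactic.RingSolver using (solve-∀)
  open import Data.Product.Base using (∃-syntax; Σ-syntax; _×_; _,_; proj₁; proj₂)
  open import Data.Sum.Base using (inj₁; inj₂)
  open import Function.Base using (id)
  open import Relation.Binary.PropositionalEquality
  open import Relation.Nullary.Decidable using (yes; no; _×-dec_)
  open import Relation.Nullary.Negation using (contradiction)

  ∈-[1⋯]⁺ : ∀ {n k} → 1 ≤ k → k ≤ n → k ∈ [1⋯ n ]
  ∈-[1⋯]⁺ {k = suc k} _ k<n = ∈-map⁺ suc (∈-upTo⁺ k<n)

  ∈-[1⋯]⁻ : ∀ {n k} → k ∈ [1⋯ n ] → 1 ≤ k × k ≤ n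
  ∈-[1⋯]⁻ k∈ with i , i∈ , refl ← ∈-map⁻ suc k∈ = s≤s z≤n , ∈-upTo⁻ i∈

  [1⋯]-sorted : ∀ n → AllPairs _<_ [1⋯ n ]
  [1⋯]-sorted n = AllPairs.map⁺ (AllPairs.map s≤s (AllPairs.applyUpTo⁺₁ id n λ i<j _ → i<j))

  sorted⇒Unique : ∀ {xs} → AllPairs _<_ xs → Unique xs
  sorted⇒Unique = AllPairs.map <⇒≢

  [1⋯1+n] : ∀ n → [1⋯ suc n ] ≡ [1⋯ n ] ++ suc n ∷ []
  [1⋯1+n] n = trans (cong (map suc) (sym (upTo-∷ʳ n))) (map-++ suc (upTo n) (n ∷ []))

  primeDivisors-sorted : ∀ n → AllPairs _<_ (primeDivisors n)
  primeDivisors-sorted n = AllPairs.filter⁺ _ ([1⋯]-sorted n)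

  module _ {n : ℕ} .{{_ : NonZero n}} where
    ∈-primeDivisors⁺ : ∀ {p} → Prime p → p ∣ n → p ∈ primeDivisors n
    ∈-primeDivisors⁺ pp p∣n =
      ∈-filter⁺ _ (∈-[1⋯]⁺ (>-nonZero⁻¹ _ {{prime⇒nonZero pp}}) (∣⇒≤ p∣n)) (pp , p∣n)

    ∈-primeDivisors⁻ : ∀ {p} → p ∈ primeDivisors n → Prime p × p ∣ n
    ∈-primeDivisors⁻ p∈ = proj₂ (∈-filter⁻ (λ p → prime? p ×-dec p ∣? n) {xs = [1⋯ n ]} p∈)

    -- Serves both for products of coprime arguments and for the squarefree part of `k`.
    product-primes≤R : ∀ {ps} → Unique ps → (∀ {p} → p ∈ ps → Prime p × p ∣ n) → product ps ≤ R n
    product-primes≤R {ps} uniq prime-∣ = subst₂ _≤_ (cong product (map-id ps)) (cong product (map-id (primeDivisors n)))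
      (Unique-⊆⇒product≤ id uniq
        (λ p∈ → let pp , p∣n = prime-∣ p∈ in ∈-primeDivisors⁺ pp p∣n)
        (λ p∈ → >-nonZero⁻¹ _ {{prime⇒nonZero (proj₁ (∈-primeDivisors⁻ p∈))}}))

  1≤R : ∀ n → 1 ≤ R n
  1≤R n = >-nonZero⁻¹ (R n) {{R≢0 n}}

  Coprime⇒Disjoint-primeDivisors : ∀ {m n} .{{_ : NonZero m}} .{{_ : NonZero n}} →
                                   Coprime m n → Disjoint (primeDivisors m) (primeDivisors n)
  Coprime⇒Disjoint-primeDivisors cop (p∈m , p∈n)
    with pp , p∣m ← ∈-primeDivisors⁻ p∈m | _ , p∣n ← ∈-primeDivisors⁻ p∈n
    with refl ← cop (p∣m , p∣n) = ¬prime[1] pp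

  R-*-coprime : ∀ {m n} .{{_ : NonZero m}} .{{_ : NonZero n}} → Coprime m n → R m * R n ≤ R (m * n)
  R-*-coprime {m} {n} cop = subst (_≤ R (m * n)) (product-++ (primeDivisors m) _)
    (product-primes≤R {{m*n≢0 m n}}
      (Unique.++⁺ (sorted⇒Unique (primeDivisors-sorted m)) (sorted⇒Unique (primeDivisors-sorted n))
                  (Coprime⇒Disjoint-primeDivisors cop))
      prime-∣)
    where
    prime-∣ : ∀ {p} → p ∈ primeDivisors m ++ primeDivisors n → Prime p × p ∣ m * n
    prime-∣ p∈ with ∈-++⁻ (primeDivisors m) p∈
    ... | inj₁ p∈m = let pp , p∣m = ∈-primeDivisors⁻ p∈m in pp , ∣m⇒∣m*n n p∣m
    ... | inj₂ p∈n = let pp , p∣n = ∈-primeDivisors⁻ p∈n in pp , ∣n⇒∣m*n m p∣n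

  -- Primes are absorbed one at a time: a prime already in `rs` is taken out and, paired with the
  -- new copy, multiplies `d`; any other joins `rs`.
  squarefreePart : ∀ ps → All Prime ps →
    ∃[ d ] Σ[ rs ∈ List ℕ ] product ps ≡ d ^ 2 * product rs × Unique rs × All Prime rs
  squarefreePart []       []         = 1 , [] , refl , [] , []
  squarefreePart (p ∷ ps) (pp ∷ pps)
    with d , rs , eq , uniq , prs ← squarefreePart ps pps | p ∈? rs
  ... | no p∉rs = d , p ∷ rs , trans (cong (p *_) eq) (x∙yz≈y∙xz p (d ^ 2) (product rs)) , ¬Any⇒All¬ rs p∉rs ∷ uniq , pp ∷ prs
  ... | yes p∈rs with as , bs , refl ← ∈-∃++ p∈rs =
    d * p , as ++ bs ,
    trans (cong (p *_) (trans eq (cong (d ^ 2 *_) (product-↭ (shift p as bs))))) (absorb p d (product (as ++ bs))) ,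
    Unique-remove as uniq ,
    All.tail (All-resp-↭ (shift p as bs) prs)
    where
    absorb : ∀ p d r → p * (d ^ 2 * (p * r)) ≡ (d * p) ^ 2 * r
    absorb p d r rewrite *-identityʳ d | *-identityʳ (d * p) = reassoc p d r
      where
      reassoc : ∀ p d r → p * (d * d * (p * r)) ≡ d * p * (d * p) * r
      reassoc = solve-∀
    Unique-remove : ∀ {x : ℕ} as {bs} → Unique (as ++ x ∷ bs) → Unique (as ++ bs)
    Unique-remove []       (_ ∷ u)   = u
    Unique-remove (a ∷ as) (a∉ ∷ u) = All.tail (All-resp-↭ (shift _ as _) a∉) ∷ Unique-remove as u

  dyadic : ∀ d .{{_ : NonZero d}} → ∃[ j ] 2 ^ j ≤ d × d < 2 ^ suc j
  dyadic 1 = 0 , s≤s z≤n , s≤s (s≤s z≤n)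
  dyadic (suc d@(suc _)) with j , 2^j≤d , d<2^1+j ← dyadic d | suc d <? 2 ^ suc j
  ... | yes 1+d< = j , m≤n⇒m≤1+n 2^j≤d , 1+d<
  ... | no  1+d≮ = suc j , ≮⇒≥ 1+d≮ , ≤-<-trans d<2^1+j (m<m+n (2 ^ suc j) (≤-trans (m^n>0 2 (suc j)) (m≤m+n _ 0)))

  n<2^n : ∀ n → n < 2 ^ n
  n<2^n zero    = s≤s z≤n
  n<2^n (suc n) = <-≤-trans (s≤s (n<2^n n)) (≤-trans (+-monoˡ-≤ (2 ^ n) (m^n>0 2 n)) (+-monoʳ-≤ (2 ^ n) (m≤m+n _ 0)))

  -- A single summand of `weight` suffices, that of the block containing `d`. Its index lies below
  -- `J` because j < 2ʲ ≤ d ≤ J.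
  weight-log : ∀ {J k d} .{{_ : NonZero d}} → d ≤ J → d ^ 2 ∣ k → d ≤ 2 ^ weight J k
  weight-log {J} {k} {d} d≤J d²∣k with j , 2^j≤d , d<2^1+j ← dyadic d =
    ≤-trans (<⇒≤ d<2^1+j) (^-monoʳ-≤ 2 (begin
      suc j                    ≡⟨ *-identityʳ (suc j) ⟨
      suc j * 1                ≤⟨ *-monoʳ-≤ (suc j) 1≤blockCount ⟩
      suc j * blockCount j k   ≤⟨ f[i]≤Σ< J _ (<-≤-trans (n<2^n j) (≤-trans 2^j≤d d≤J)) ⟩
      weight J k               ∎))
    where
    open ≤-Reasoning
    d≡ : 2 ^ j + (d ∸ 2 ^ j) ≡ d
    d≡ = m+[n∸m]≡n 2^j≤d
    d∸2^j< : d ∸ 2 ^ j < 2 ^ j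
    d∸2^j< = +-cancelˡ-< (2 ^ j) _ _ (subst₂ _<_ (sym d≡) (cong (2 ^ j +_) (+-identityʳ _)) d<2^1+j)
    1≤blockCount : 1 ≤ blockCount j k
    1≤blockCount = begin
      1                                            ≡⟨ ind-yes (_ ∣? k) (subst (λ x → x ^ 2 ∣ k) (sym d≡) d²∣k) ⟨
      ind ((2 ^ j + (d ∸ 2 ^ j)) ^ 2 ∣? k)         ≤⟨ f[i]≤Σ< (2 ^ j) (λ i → ind ((2 ^ j + i) ^ 2 ∣? k)) d∸2^j< ⟩
      blockCount j k                               ∎

  -- The square factor d² is replaced by `4 ^ weight J k`, which no longer mentions d and can be
  -- multiplied over all `k`.
  k≤R*4^weight : ∀ {J k} → 1 ≤ k → k ≤ J → k ≤ R k * 4 ^ weight J k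
  k≤R*4^weight {J} {k@(suc _)} 1≤k k≤J
    with d , rs , product≡ , uniq , prs ← squarefreePart (factorise k .PrimeFactorisation.factors)
                                                         (factorise k .PrimeFactorisation.factorsPrime) = begin
    k                      ≡⟨ k≡ ⟩
    d ^ 2 * product rs     ≤⟨ *-mono-≤ (^-monoˡ-≤ 2 (weight-log {{d≢0}} d≤J (divides (product rs) (trans k≡ (*-comm (d ^ 2) _)))))
                                       (product-primes≤R uniq λ {p} p∈ → All.lookup prs p∈ ,
                                         subst (p ∣_) (sym k≡) (∣n⇒∣m*n (d ^ 2) (∈⇒∣product p∈))) ⟩
    (2 ^ w) ^ 2 * R k      ≡⟨ *-comm ((2 ^ w) ^ 2) (R k) ⟩
    R k * (2 ^ w) ^ 2      ≡⟨ cong (R k *_) (trans (^-*-assoc 2 w 2) (trans (cong (2 ^_) (*-comm w 2)) (sym (^-*-assoc 2 2 w)))) ⟩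
    R k * 4 ^ w            ∎
    where
    open ≤-Reasoning
    w = weight J k
    k≡ : k ≡ d ^ 2 * product rs
    k≡ = trans (factorise k .PrimeFactorisation.isFactorisation) product≡
    d≢0 : NonZero d
    d≢0 = ≢-nonZero λ { refl → contradiction k≡ λ () }
    d≤J : d ≤ J
    d≤J = ≤-trans (∣⇒≤ (divides (d * product rs) (trans k≡ (regroup d (product rs))))) k≤J
      where
      regroup : ∀ d r → d ^ 2 * r ≡ d * r * d
      regroup d r rewrite *-identityʳ d = trans (*-assoc d d r) (*-comm d (d * r))

-- Coprime pairs, totatives and the product of their radicals.

module Totatives where
  open ListProducts
  open SquareWeights
  open Radicals
  open import Defs using (R; R≢0; φ; G; coprimePairs; [1⋯_])
  open import Data.List.Base using (List; []; _∷_; _++_; map; length; filter)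
  open import Data.List.Membership.Propositional using (_∈_)
  open import Data.List.Membership.Propositional.Properties
    using (∈-map⁺; ∈-map⁻; ∈-filter⁺; ∈-filter⁻; ∈-++⁺ˡ; ∈-++⁺ʳ)
  open import Data.List.Properties using (length-++; length-map; map-id; map-∘)
  open import Data.List.Relation.Binary.Subset.Propositional using (_⊆_)
  open import Data.List.Relation.Unary.All as All using (All; []; _∷_)
  open import Data.List.Relation.Unary.AllPairs as AllPairs using (AllPairs; []; _∷_)
  import Data.List.Relation.Unary.AllPairs.Properties as AllPairs
  open import Data.Nat.Base
  open import Data.Nat.Coprimality as Coprimality using (Coprime; coprime?)
  open import Data.Nat.Divisibility
  open import Data.Nat.ListAction using (product)
  open import Data.Nat.Properties
  open import Data.Nat.Tactic.RingSolver using (solve-∀)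
  open import Algebra.Properties.CommutativeSemigroup *-commutativeSemigroup using (interchange; x∙yz≈y∙xz)
  open import Data.Product.Base using (_×_; _,_; proj₁; proj₂)
  open import Function.Base using (id; _∘_)
  open import Relation.Binary.Definitions using (tri<; tri≈; tri>)
  open import Relation.Binary.PropositionalEquality
  open import Relation.Nullary.Decidable using (_×-dec_)
  open import Relation.Nullary.Negation using (contradiction)

  ^-distribʳ-* : ∀ o m n → (m * n) ^ o ≡ m ^ o * n ^ o
  ^-distribʳ-* zero    m n = refl
  ^-distribʳ-* (suc o) m n = trans (cong (m * n *_) (^-distribʳ-* o m n)) (interchange m n (m ^ o) (n ^ o))

  -- The very list measured by `φ`, so `length (totatives c)` is `φ c` by definition.
  totatives : ℕ → List ℕ
  totatives c = filter (λ k → coprime? k c) [1⋯ c ]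

  totatives-sorted : ∀ c → AllPairs _<_ (totatives c)
  totatives-sorted c = AllPairs.filter⁺ _ ([1⋯]-sorted c)

  ∈-totatives⁻ : ∀ {c k} → k ∈ totatives c → 1 ≤ k × k ≤ c × Coprime k c
  ∈-totatives⁻ {c} k∈ with k∈[1⋯c] , cop ← ∈-filter⁻ (λ k → coprime? k c) {xs = [1⋯ c ]} k∈ =
    let 1≤k , k≤c = ∈-[1⋯]⁻ k∈[1⋯c] in 1≤k , k≤c , cop

  ∈-coprimePairs⁺ : ∀ {c a} → 1 ≤ a → a < c ∸ a → Coprime a (c ∸ a) → (a , c ∸ a) ∈ coprimePairs c
  ∈-coprimePairs⁺ {c} {a} 1≤a a<c∸a cop =
    ∈-filter⁺ (λ (a , b) → a <? b ×-dec coprime? a b) (∈-map⁺ (λ a → a , c ∸ a) (∈-[1⋯]⁺ 1≤a (≤-trans (<⇒≤ a<c∸a) (m∸n≤m c a)))) (a<c∸a , cop)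

  ∈-coprimePairs⁻ : ∀ {c a b} → (a , b) ∈ coprimePairs c → 1 ≤ a × a < b × Coprime a b × a + b ≡ c
  ∈-coprimePairs⁻ {c} ab∈ with ab∈map , a<b , cop ← ∈-filter⁻ (λ (a , b) → a <? b ×-dec coprime? a b) {xs = map (λ a → a , c ∸ a) [1⋯ c ]} ab∈
    with k , k∈ , refl ← ∈-map⁻ (λ a → a , c ∸ a) ab∈map =
    proj₁ (∈-[1⋯]⁻ k∈) , a<b , cop , m+[n∸m]≡n (proj₂ (∈-[1⋯]⁻ k∈))

  Coprime-∸ : ∀ {k c} → k ≤ c → Coprime k c → Coprime k (c ∸ k)
  Coprime-∸ k≤c cop (d∣k , d∣c∸k) = cop (d∣k , subst (_ ∣_) (m+[n∸m]≡n k≤c) (∣m∣n⇒∣m+n d∣k d∣c∸k))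

  pairEntries : ℕ → List ℕ
  pairEntries c = map proj₁ (coprimePairs c) ++ map proj₂ (coprimePairs c)

  -- A totative is the smaller or the larger entry of its pair with `c ∸ k`. A tie would give
  -- `c = k + k`, so `k` would divide `c` and be 1, against `3 ≤ c`.
  totatives⊆pairEntries : ∀ {c} → 3 ≤ c → totatives c ⊆ pairEntries c
  totatives⊆pairEntries {c} 3≤c {k} k∈ with 1≤k , k≤c , cop ← ∈-totatives⁻ k∈ with <-cmp k (c ∸ k)
  ... | tri< k<c∸k _ _ = ∈-++⁺ˡ (∈-map⁺ proj₁ (∈-coprimePairs⁺ 1≤k k<c∸k (Coprime-∸ k≤c cop)))
  ... | tri≈ _ k≡c∸k _ = contradiction (subst (3 ≤_) c≡2 3≤c) λ { (s≤s (s≤s ())) }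
    where
    c≡k+k : c ≡ k + k
    c≡k+k = trans (sym (m+[n∸m]≡n k≤c)) (cong (k +_) (sym k≡c∸k))
    k≡1 : k ≡ 1
    k≡1 = cop (∣-refl , subst (k ∣_) (sym c≡k+k) (∣m∣n⇒∣m+n ∣-refl ∣-refl))
    c≡2 : c ≡ 2
    c≡2 = trans c≡k+k (cong₂ _+_ k≡1 k≡1)
  ... | tri> _ _ c∸k<k = ∈-++⁺ʳ (map proj₁ (coprimePairs c))
    (subst (_∈ map proj₂ (coprimePairs c)) c∸[c∸k]≡k
      (∈-map⁺ proj₂ (∈-coprimePairs⁺ (m<n⇒0<n∸m k<c)
        (subst (c ∸ k <_) (sym c∸[c∸k]≡k) c∸k<k)
        (subst (Coprime (c ∸ k)) (sym c∸[c∸k]≡k) (Coprimality.sym (Coprime-∸ k≤c cop))))))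
    where
    c∸[c∸k]≡k : c ∸ (c ∸ k) ≡ k
    c∸[c∸k]≡k = m∸[m∸n]≡n k≤c
    -- If `k` were `c`, it would be coprime to itself and hence 1.
    k<c : k < c
    k<c = ≤∧≢⇒< k≤c λ { refl → contradiction (subst (3 ≤_) (cop (∣-refl , ∣-refl)) 3≤c) λ { (s≤s ()) } }

  φ≤2*length-coprimePairs : ∀ {c} → 3 ≤ c → φ c ≤ 2 * length (coprimePairs c)
  φ≤2*length-coprimePairs {c} 3≤c = begin
    length (totatives c)     ≤⟨ Unique-⊆⇒length≤ (sorted⇒Unique (totatives-sorted c)) (totatives⊆pairEntries 3≤c) ⟩
    length (pairEntries c)   ≡⟨ length-++ (map proj₁ (coprimePairs c)) ⟩
    length (map proj₁ (coprimePairs c)) + length (map proj₂ (coprimePairs c))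
                             ≡⟨ cong₂ _+_ (length-map proj₁ (coprimePairs c)) (trans (length-map proj₂ (coprimePairs c)) (sym (+-identityʳ _))) ⟩
    2 * length (coprimePairs c) ∎
    where open ≤-Reasoning

  product-map-const : ∀ {A : Set} m (xs : List A) → product (map (λ _ → m) xs) ≡ m ^ length xs
  product-map-const m []       = refl
  product-map-const m (x ∷ xs) = cong (m *_) (product-map-const m xs)

  -- The numbers `a`, `b` and `a + b` are pairwise coprime. A common divisor of `a * b` and `a + b`
  -- is coprime to `a`, since whatever it shares with `a` divides `b` as well; so it divides `b`,
  -- and being coprime to `b` too it is 1.
  R-triple : ∀ {c a b} → (a , b) ∈ coprimePairs c → R a * R b * R c ≤ R (a * b * c)
  R-triple {c} {a} {b} ab∈ with 1≤a , a<b , cop , refl ← ∈-coprimePairs⁻ {c} ab∈ = begin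
    R a * R b * R (a + b)    ≤⟨ *-monoˡ-≤ (R (a + b)) (R-*-coprime cop) ⟩
    R (a * b) * R (a + b)    ≤⟨ R-*-coprime {{m*n≢0 a b}} {{>-nonZero (≤-trans 1≤a (m≤m+n a b))}} ab⊥a+b ⟩
    R (a * b * (a + b))      ∎
    where
    open ≤-Reasoning
    instance
      a≢0 : NonZero a
      a≢0 = >-nonZero 1≤a
      b≢0 : NonZero b
      b≢0 = >-nonZero (≤-<-trans z≤n a<b)
    ab⊥a+b : Coprime (a * b) (a + b)
    ab⊥a+b {d} (d∣ab , d∣a+b) = d⊥b (∣-refl , d∣b)
      where
      d⊥a : Coprime d a
      d⊥a (e∣d , e∣a) = cop (e∣a , ∣m+n∣m⇒∣n (∣-trans e∣d d∣a+b) e∣a)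
      d⊥b : Coprime d b
      d⊥b {e} (e∣d , e∣b) = cop (∣m+n∣m⇒∣n (subst (e ∣_) (+-comm a b) (∣-trans e∣d d∣a+b)) e∣b , e∣b)
      d∣b : d ∣ b
      d∣b = Coprimality.coprime-divisor d⊥a d∣ab

  -- Squaring removes the half from the number φ(c) / 2 of pairs.
  G-lower : ∀ {c} → 3 ≤ c → product (map R (totatives c)) ^ 2 * R c ^ φ c ≤ G c ^ 2
  G-lower {c} 3≤c = begin
    P ^ 2 * R c ^ φ c                       ≤⟨ *-mono-≤ (^-monoˡ-≤ 2 P≤Q) (^-monoʳ-≤ (R c) {{R≢0 c}} (φ≤2*length-coprimePairs 3≤c)) ⟩
    Q ^ 2 * R c ^ (2 * n)                   ≡⟨ cong (Q ^ 2 *_) (trans (cong (R c ^_) (*-comm 2 n)) (sym (^-*-assoc (R c) n 2))) ⟩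
    Q ^ 2 * (R c ^ n) ^ 2                   ≡⟨ ^-distribʳ-* 2 Q (R c ^ n) ⟨
    (Q * R c ^ n) ^ 2                       ≤⟨ ^-monoˡ-≤ 2 Q*R^n≤G ⟩
    G c ^ 2                                 ∎
    where
    open ≤-Reasoning
    ps = coprimePairs c
    n = length ps
    P = product (map R (totatives c))
    Q = product (map R (pairEntries c))
    P≤Q : P ≤ Q
    P≤Q = Unique-⊆⇒product≤ R (sorted⇒Unique (totatives-sorted c)) (totatives⊆pairEntries 3≤c) (λ {k} _ → 1≤R k)
    Q*R^n≤G : Q * R c ^ n ≤ G c
    Q*R^n≤G = begin
      Q * R c ^ n
        ≡⟨ cong₂ _*_ (product-map-++ R (map proj₁ ps) (map proj₂ ps)) (sym (product-map-const (R c) ps)) ⟩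
      product (map R (map proj₁ ps)) * product (map R (map proj₂ ps)) * product (map (λ _ → R c) ps)
        ≡⟨ cong₂ (λ xs ys → product xs * product ys * product (map (λ _ → R c) ps)) (sym (map-∘ ps)) (sym (map-∘ ps)) ⟩
      product (map (R ∘ proj₁) ps) * product (map (R ∘ proj₂) ps) * product (map (λ _ → R c) ps)
        ≡⟨ cong (_* product (map (λ _ → R c) ps)) (product-map-* (R ∘ proj₁) (R ∘ proj₂) ps) ⟨
      product (map (λ (a , b) → R a * R b) ps) * product (map (λ _ → R c) ps)
        ≡⟨ product-map-* (λ (a , b) → R a * R b) (λ _ → R c) ps ⟨
      product (map (λ (a , b) → R a * R b * R c) ps)
        ≤⟨ product-map-mono _ _ ps R-triple ⟩
      G c ∎

  -- The i-th entry is at least `x + i`. The floor `x` is general so that it can rise along the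
  -- induction; the case in use is `x = 0`.
  product-sorted : ∀ x {xs} → AllPairs _<_ xs → All (x <_) xs → (x + length xs) ! ≤ x ! * product xs
  product-sorted x [] [] = ≤-reflexive (trans (cong _! (+-identityʳ x)) (sym (*-identityʳ (x !))))
  product-sorted x {y ∷ ys} (y<ys ∷ sorted) (x<y ∷ _) = begin
    (x + suc (length ys)) !    ≡⟨ cong _! (+-suc x _) ⟩
    (suc x + length ys) !      ≤⟨ product-sorted (suc x) sorted (All.map (≤-<-trans x<y) y<ys) ⟩
    suc x * x ! * product ys   ≤⟨ *-monoˡ-≤ (product ys) (*-monoˡ-≤ (x !) x<y) ⟩
    y * x ! * product ys       ≡⟨ trans (cong (_* product ys) (*-comm y (x !))) (*-assoc (x !) y _) ⟩
    x ! * (y * product ys)     ∎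
    where open ≤-Reasoning

  m!*m^n≤[m+n]! : ∀ m n → m ! * m ^ n ≤ (m + n) !
  m!*m^n≤[m+n]! m zero    = ≤-reflexive (trans (*-identityʳ (m !)) (cong _! (sym (+-identityʳ m))))
  m!*m^n≤[m+n]! m (suc n) = begin
    m ! * (m * m ^ n)        ≡⟨ x∙yz≈y∙xz (m !) m (m ^ n) ⟩
    m * (m ! * m ^ n)        ≤⟨ *-mono-≤ (≤-trans (m≤m+n m n) (n≤1+n _)) (m!*m^n≤[m+n]! m n) ⟩
    suc (m + n) * (m + n) !  ≡⟨ cong _! (+-suc m n) ⟨
    (m + suc n) !            ∎
    where
    open ≤-Reasoning

  -- The bound 4ⁿ for the central binomial coefficient: each step multiplies it by at most (2n + 2)²
  -- / (n + 1)² = 4.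
  [n+n]!≤4^n*n!² : ∀ n → (n + n) ! ≤ 4 ^ n * (n ! * n !)
  [n+n]!≤4^n*n!² zero    = ≤-refl
  [n+n]!≤4^n*n!² (suc n) = begin
    (suc n + suc n) !                                ≡⟨ cong (λ k → suc k !) (+-suc n n) ⟩
    suc (suc (n + n)) * (suc (n + n) * (n + n) !)    ≤⟨ *-monoʳ-≤ (suc (suc (n + n))) (*-mono-≤ (n≤1+n (suc (n + n))) ([n+n]!≤4^n*n!² n)) ⟩
    suc (suc (n + n)) * (suc (suc (n + n)) * (4 ^ n * (n ! * n !))) ≡⟨ regroup n (4 ^ n) (n !) ⟩
    4 * 4 ^ n * (suc n * n ! * (suc n * n !))        ∎
    where
    open ≤-Reasoning
    regroup : ∀ n p f → suc (suc (n + n)) * (suc (suc (n + n)) * (p * (f * f))) ≡ 4 * p * (suc n * f * (suc n * f))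
    regroup = solve-∀

  -- A Stirling-type bound with 4 in place of e: the upper half of the factors of `(n + n) !` are
  -- all at least `n`.
  n^n≤4^n*n! : ∀ n → n ^ n ≤ 4 ^ n * n !
  n^n≤4^n*n! n = *-cancelˡ-≤ (n !) {{n !≢0}} (begin
    n ! * n ^ n             ≤⟨ m!*m^n≤[m+n]! n n ⟩
    (n + n) !               ≤⟨ [n+n]!≤4^n*n!² n ⟩
    4 ^ n * (n ! * n !)     ≡⟨ x∙yz≈y∙xz (4 ^ n) (n !) (n !) ⟩
    n ! * (4 ^ n * n !)     ∎)
    where
    open ≤-Reasoning

  product-weights : ∀ n J → product (map (λ k → 4 ^ weight J k) [1⋯ n ]) ≡ 4 ^ Σ< n (λ i → weight J (suc i))
  product-weights zero    J = refl
  product-weights (suc n) J = begin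
    product (map f [1⋯ suc n ])                                  ≡⟨ cong (product ∘ map f) ([1⋯1+n] n) ⟩
    product (map f ([1⋯ n ] ++ suc n ∷ []))                      ≡⟨ product-map-++ f [1⋯ n ] _ ⟩
    product (map f [1⋯ n ]) * (f (suc n) * 1)                    ≡⟨ cong₂ _*_ (product-weights n J) (*-identityʳ _) ⟩
    4 ^ Σ< n (λ i → weight J (suc i)) * 4 ^ weight J (suc n)     ≡⟨ ^-distribˡ-+-* 4 (Σ< n _) (weight J (suc n)) ⟨
    4 ^ Σ< (suc n) (λ i → weight J (suc i))                      ∎
    where
    open ≡-Reasoning
    f = λ k → 4 ^ weight J k

  φ^φ≤ : ∀ c → φ c ^ φ c ≤ 4 ^ φ c * (product (map R (totatives c)) * 4 ^ (4 * c))
  φ^φ≤ c = begin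
    φ c ^ φ c                   ≤⟨ n^n≤4^n*n! (φ c) ⟩
    4 ^ φ c * φ c !             ≤⟨ *-monoʳ-≤ (4 ^ φ c) (begin
      φ c !                       ≤⟨ product-sorted 0 (totatives-sorted c) (All.tabulate (λ k∈ → proj₁ (∈-totatives⁻ {c} k∈))) ⟩
      1 * product ks              ≡⟨ *-identityˡ _ ⟩
      product ks                  ≡⟨ cong product (map-id ks) ⟨
      product (map id ks)         ≤⟨ product-map-mono id (λ k → R k * 4 ^ weight c k) ks
                                      (λ k∈ → let 1≤k , k≤c , _ = ∈-totatives⁻ {c} k∈ in k≤R*4^weight 1≤k k≤c) ⟩
      product (map (λ k → R k * 4 ^ weight c k) ks) ≡⟨ product-map-* R (λ k → 4 ^ weight c k) ks ⟩
      product (map R ks) * product (map (λ k → 4 ^ weight c k) ks)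
        ≤⟨ *-monoʳ-≤ (product (map R ks)) (begin
          -- The weights are controlled only in sum over all `k ≤ c`, so the product is enlarged
          -- from the totatives to `[1⋯ c ]`, every factor being at least 1.
          product (map (λ k → 4 ^ weight c k) ks) ≤⟨ Unique-⊆⇒product≤ _ (sorted⇒Unique (totatives-sorted c)) (λ k∈ → proj₁ (∈-filter⁻ (λ k → coprime? k c) {xs = [1⋯ c ]} k∈)) (λ {k} _ → m^n>0 4 (weight c k)) ⟩
          product (map (λ k → 4 ^ weight c k) [1⋯ c ]) ≡⟨ product-weights c c ⟩
          4 ^ Σ< c (λ i → weight c (suc i))        ≤⟨ ^-monoʳ-≤ 4 (Σ-weight c c) ⟩
          4 ^ (4 * c) ∎) ⟩
      product (map R ks) * 4 ^ (4 * c) ∎) ⟩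
    4 ^ φ c * (product (map R ks) * 4 ^ (4 * c)) ∎
    where
    open ≤-Reasoning
    ks = totatives c

-- The sieve of Eratosthenes, Legendre's formula and the size of c / φ(c).

module Sieve where
  open ListProducts
  open SquareWeights
  open Radicals
  open Totatives
  open import Defs using (R; φ; primeDivisors; [1⋯_]; subsets; ∏ℕ; ∏ℕ≢0; Factorisation)
  open import Data.Bool.Base using (if_then_else_)
  open import Data.Fin.Base using (Fin; zero; suc)
  open import Data.Fin.Properties using (any?; suc-injective)
  open import Data.Fin.Subset using (Subset; inside; outside; ∣_∣)
  open import Data.Integer.Base as ℤ using (ℤ; +_; 0ℤ; -1ℤ)
  import Data.Integer.Properties as ℤ
  open import Data.List.Base as List using (List; []; _∷_; _++_; map; length; filter; tabulate)
  open import Data.List.Membership.Propositional using (_∈_)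
  open import Data.List.Membership.Propositional.Properties using (∈-tabulate⁺; ∈-tabulate⁻)
  open import Data.List.Properties using (map-id; map-∘; map-cong; filter-++; length-++; length-tabulate)
  open import Data.List.Relation.Binary.Permutation.Propositional using (_↭_)
  open import Data.List.Relation.Binary.Permutation.Propositional.Properties using (↭-length) renaming (map⁺ to ↭-map⁺)
  open import Data.List.Relation.Unary.All as All using (All; []; _∷_)
  open import Data.List.Relation.Unary.AllPairs using (AllPairs; []; _∷_)
  import Data.List.Relation.Unary.Unique.Propositional.Properties as Unique
  open import Data.Nat.Base
  open import Data.Nat.Coprimality as Coprimality using (Coprime; coprime?)
  open import Data.Nat.Divisibility
  open import Data.Nat.DivMod using (m/n/o≡m/[n*o]; m*n/n≡m; n/1≡n; /-congʳ; _/_)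
  open import Data.Nat.ListAction using (product)
  open import Data.Nat.ListAction.Properties using (product-↭)
  open import Data.Nat.Primality
  open import Data.Nat.Properties hiding (suc-injective)
  open import Data.Nat.Tactic.RingSolver using (solve-∀)
  open import Algebra.Properties.CommutativeSemigroup *-commutativeSemigroup using (interchange; x∙yz≈y∙xz)
  open import Data.Product.Base using (∃-syntax; _,_; proj₁)
  open import Data.Sum.Base using (_⊎_; inj₁; inj₂)
  import Data.Vec.Base as Vec
  open import Function.Base using (id; _∘_)
  open import Function.Definitions using (Injective)
  open import Relation.Binary.PropositionalEquality
  open import Relation.Nullary.Decidable using (yes; no; ¬?; Dec)
  open import Relation.Nullary.Negation using (contradiction)
  open import Relation.Unary using (Decidable; Pred)

  private variable
    n : ℕ

  prime-∣-prime⇒≡ : ∀ {p q} → Prime p → Prime q → p ∣ q → p ≡ q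
  prime-∣-prime⇒≡ pp pq p∣q with prime⇒irreducible pq p∣q
  ... | inj₁ refl = contradiction pp ¬prime[1]
  ... | inj₂ p≡q  = p≡q

  -- The indicator of surviving the sieve, written as a product so that the first prime splits off
  -- by unfolding.
  χ : (Fin n → ℕ) → ℕ → ℕ
  χ {zero}  q m = 1
  χ {suc n} q m = ind (¬? (q zero ∣? m)) * χ (q ∘ suc) m

  count : (Fin n → ℕ) → ℕ → ℕ
  count q y = Σ< y (λ i → χ q (suc i))

  ind-cong : ∀ {P Q : Set} (P? : Dec P) (Q? : Dec Q) → (P → Q) → (Q → P) → ind P? ≡ ind Q?
  ind-cong P? (yes q) f g = ind-yes P? (g q)
  ind-cong P? (no ¬q) f g = ind-no P? (¬q ∘ f)

  ind-¬ : ∀ {P : Set} (P? : Dec P) x → ind (¬? P?) * x + ind P? * x ≡ x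
  ind-¬ (yes _) x = +-identityʳ x
  ind-¬ (no  _) x = trans (+-identityʳ _) (+-identityʳ x)

  χ-*-prime : ∀ (q : Fin n → ℕ) {p} → (∀ i → Prime (q i)) → Prime p → (∀ i → q i ≢ p) → ∀ m → χ q (p * m) ≡ χ q m
  χ-*-prime {zero}  q     pq pp q≢p m = refl
  χ-*-prime {suc n} q {p} pq pp q≢p m = cong₂ _*_
    (ind-cong (¬? (q zero ∣? p * m)) (¬? (q zero ∣? m))
      (λ ∤pm ∣m → ∤pm (∣n⇒∣m*n p ∣m)) ∣pm⇒∣m)
    (χ-*-prime (q ∘ suc) (pq ∘ suc) pp (q≢p ∘ suc) m)
    where
    ∣pm⇒∣m : q zero ∤ m → q zero ∤ p * m
    ∣pm⇒∣m ∤m ∣pm with euclidsLemma p m (pq zero) ∣pm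
    ... | inj₁ ∣p = q≢p zero (prime-∣-prime⇒≡ (pq zero) pp ∣p)
    ... | inj₂ ∣m = ∤m ∣m

  module _ (q : Fin (suc n) → ℕ) (pq : ∀ i → Prime (q i)) (inj : Injective _≡_ _≡_ q) where
    private instance
      q₀≢0 : NonZero (q zero)
      q₀≢0 = prime⇒nonZero (pq zero)

    -- Legendre's recursion, kept additive to stay in ℕ. The survivors of the other primes that
    -- `q zero` strikes out are `q zero * m` with `m ≤ y / q zero`, and `m` survives the other
    -- primes exactly when `q zero * m` does.
    count-suc : ∀ y → count q y + count (q ∘ suc) (y / q zero) ≡ count (q ∘ suc) y
    count-suc y = begin
      count q y + count (q ∘ suc) (y / q zero)
        ≡⟨ cong (λ k → count q y + k) (Σ<-cong (y / q zero) (λ i → χ-*-prime (q ∘ suc) (pq ∘ suc) (pq zero) (λ j eq → contradiction (inj eq) λ ()) (suc i))) ⟨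
      count q y + Σ< (y / q zero) (λ i → χ (q ∘ suc) (q zero * suc i))
        ≡⟨ cong (λ k → count q y + k) (Σ<-multiples (q zero) y (χ (q ∘ suc))) ⟨
      count q y + Σ< y (λ i → ind (q zero ∣? suc i) * χ (q ∘ suc) (suc i))
        ≡⟨ Σ<-+ y _ _ ⟨
      Σ< y (λ i → χ q (suc i) + ind (q zero ∣? suc i) * χ (q ∘ suc) (suc i))
        ≡⟨ Σ<-cong y (λ i → ind-¬ (q zero ∣? suc i) _) ⟩
      count (q ∘ suc) y ∎
      where open ≡-Reasoning

  -- The same expression as `∏[_]q`, freed from the factorisation record so that induction on the
  -- number of primes is possible.
  ∏ₛ : (Fin n → ℕ) → Subset n → ℕ
  ∏ₛ q S = ∏ℕ (λ j → if Vec.lookup S j then q j else 1)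

  ∏ₛ≢0 : (q : Fin n → ℕ) → (∀ i → NonZero (q i)) → ∀ S → NonZero (∏ₛ q S)
  ∏ₛ≢0 q q≢0 S = ∏ℕ≢0 _ factor≢0
    where
    factor≢0 : ∀ j → NonZero (if Vec.lookup S j then q j else 1)
    factor≢0 j with Vec.lookup S j
    ... | inside  = q≢0 j
    ... | outside = _

  Σℤ : {A : Set} → (A → ℤ) → List A → ℤ
  Σℤ f xs = List.foldr ℤ._+_ 0ℤ (map f xs)

  Σℤ-++ : ∀ {A : Set} (f : A → ℤ) xs ys → Σℤ f (xs ++ ys) ≡ Σℤ f xs ℤ.+ Σℤ f ys
  Σℤ-++ f []       ys = sym (ℤ.+-identityˡ _)
  Σℤ-++ f (x ∷ xs) ys = trans (cong (λ s → f x ℤ.+ s) (Σℤ-++ f xs ys)) (sym (ℤ.+-assoc (f x) _ _))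

  Σℤ-cong : ∀ {A : Set} {f g : A → ℤ} → (∀ x → f x ≡ g x) → ∀ xs → Σℤ f xs ≡ Σℤ g xs
  Σℤ-cong f≡g xs = cong (List.foldr ℤ._+_ 0ℤ) (map-cong f≡g xs)

  Σℤ-neg : ∀ {A : Set} (f : A → ℤ) xs → Σℤ (λ x → ℤ.- f x) xs ≡ ℤ.- Σℤ f xs
  Σℤ-neg f []       = refl
  Σℤ-neg f (x ∷ xs) = trans (cong (λ s → ℤ.- f x ℤ.+ s) (Σℤ-neg f xs)) (sym (ℤ.neg-distrib-+ (f x) _))

  Σℤ-map : ∀ {A B : Set} (f : B → ℤ) (g : A → B) xs → Σℤ f (map g xs) ≡ Σℤ (f ∘ g) xs
  Σℤ-map f g xs = cong (List.foldr ℤ._+_ 0ℤ) (sym (map-∘ xs))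

  signedFloor : (q : Fin n → ℕ) → (∀ i → NonZero (q i)) → ℕ → Subset n → ℤ
  signedFloor q q≢0 y S = -1ℤ ℤ.^ ∣ S ∣ ℤ.* + ((y / ∏ₛ q S) {{∏ₛ≢0 q q≢0 S}})

  -- Inclusion and exclusion by induction. Subsets without `q zero` give the count at `y` for the
  -- other primes; those with it give the negated count at `y / q zero`, because floors nest.
  -- `count-suc` evaluates the difference.
  legendre : ∀ (q : Fin n → ℕ) (pq : ∀ i → Prime (q i)) → Injective _≡_ _≡_ q → ∀ q≢0 y →
             Σℤ (signedFloor q q≢0 y) (subsets n) ≡ + count q y
  legendre {zero} q pq inj q≢0 y = begin
    1ℤ* (+ (y / 1)) ℤ.+ 0ℤ    ≡⟨ ℤ.+-identityʳ _ ⟩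
    1ℤ* (+ (y / 1))           ≡⟨ ℤ.*-identityˡ _ ⟩
    + (y / 1)                 ≡⟨ cong +_ (n/1≡n y) ⟩
    + y                       ≡⟨ cong +_ (trans (Σ<-const y 1) (*-identityʳ y)) ⟨
    + count q y               ∎
    where
    open ≡-Reasoning
    1ℤ*_ : ℤ → ℤ
    1ℤ* i = ℤ.1ℤ ℤ.* i
  legendre {suc n} q pq inj q≢0 y = begin
    Σℤ (signedFloor q q≢0 y) (map (outside Vec.∷_) (subsets n) ++ map (inside Vec.∷_) (subsets n))
      ≡⟨ Σℤ-++ _ (map (outside Vec.∷_) (subsets n)) _ ⟩
    Σℤ (signedFloor q q≢0 y) (map (outside Vec.∷_) (subsets n)) ℤ.+ Σℤ (signedFloor q q≢0 y) (map (inside Vec.∷_) (subsets n))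
      ≡⟨ cong₂ ℤ._+_ (trans (Σℤ-map _ _ (subsets n)) (Σℤ-cong outside-term (subsets n)))
                     (trans (Σℤ-map _ _ (subsets n)) (trans (Σℤ-cong inside-term (subsets n)) (Σℤ-neg _ (subsets n)))) ⟩
    Σℤ (signedFloor (q ∘ suc) (λ i → q≢0 (suc i)) y) (subsets n) ℤ.- Σℤ (signedFloor (q ∘ suc) (λ i → q≢0 (suc i)) (y / q zero)) (subsets n)
      ≡⟨ cong₂ ℤ._-_ (legendre (q ∘ suc) (pq ∘ suc) (suc-injective ∘ inj) (λ i → q≢0 (suc i)) y)
                     (legendre (q ∘ suc) (pq ∘ suc) (suc-injective ∘ inj) (λ i → q≢0 (suc i)) (y / q zero)) ⟩
    + count (q ∘ suc) y ℤ.- + count (q ∘ suc) (y / q zero)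
      ≡⟨ cong (λ k → + k ℤ.- + count (q ∘ suc) (y / q zero)) (count-suc q pq inj y) ⟨
    + (count q y + count (q ∘ suc) (y / q zero)) ℤ.- + count (q ∘ suc) (y / q zero)
      ≡⟨ ℤ.+-assoc (+ count q y) (+ count (q ∘ suc) (y / q zero)) (ℤ.- + count (q ∘ suc) (y / q zero)) ⟩
    + count q y ℤ.+ (+ count (q ∘ suc) (y / q zero) ℤ.- + count (q ∘ suc) (y / q zero))
      ≡⟨ cong (λ s → + count q y ℤ.+ s) (ℤ.+-inverseʳ (+ count (q ∘ suc) (y / q zero))) ⟩
    + count q y ℤ.+ 0ℤ
      ≡⟨ ℤ.+-identityʳ _ ⟩
    + count q y ∎
    where
    open ≡-Reasoning
    instance
      q₀≢0 : NonZero (q zero)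
      q₀≢0 = prime⇒nonZero (pq zero)

    outside-term : ∀ S → signedFloor q q≢0 y (outside Vec.∷ S) ≡ signedFloor (q ∘ suc) (λ i → q≢0 (suc i)) y S
    outside-term S = cong (λ k → -1ℤ ℤ.^ ∣ S ∣ ℤ.* + k)
      (/-congʳ {{∏ₛ≢0 q q≢0 (outside Vec.∷ S)}} {{∏ₛ≢0 (q ∘ suc) (λ i → q≢0 (suc i)) S}} (*-identityˡ (∏ₛ (q ∘ suc) S)))

    inside-term : ∀ S → signedFloor q q≢0 y (inside Vec.∷ S) ≡ ℤ.- signedFloor (q ∘ suc) (λ i → q≢0 (suc i)) (y / q zero) S
    inside-term S = begin
      -1ℤ ℤ.* -1ℤ ℤ.^ ∣ S ∣ ℤ.* + ((y / (q zero * ∏ₛ (q ∘ suc) S)) {{∏ₛ≢0 q q≢0 (inside Vec.∷ S)}})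
        ≡⟨ cong (λ k → -1ℤ ℤ.* -1ℤ ℤ.^ ∣ S ∣ ℤ.* + k)
             (m/n/o≡m/[n*o] y (q zero) (∏ₛ (q ∘ suc) S) {{_}} {{∏ₛ≢0 (q ∘ suc) (λ i → q≢0 (suc i)) S}} {{∏ₛ≢0 q q≢0 (inside Vec.∷ S)}}) ⟨
      -1ℤ ℤ.* -1ℤ ℤ.^ ∣ S ∣ ℤ.* + ((y / q zero / ∏ₛ (q ∘ suc) S) {{∏ₛ≢0 (q ∘ suc) (λ i → q≢0 (suc i)) S}})
        ≡⟨ ℤ.*-assoc -1ℤ (-1ℤ ℤ.^ ∣ S ∣) _ ⟩
      -1ℤ ℤ.* signedFloor (q ∘ suc) (λ i → q≢0 (suc i)) (y / q zero) S
        ≡⟨ ℤ.-1*i≡-i _ ⟩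
      ℤ.- signedFloor (q ∘ suc) (λ i → q≢0 (suc i)) (y / q zero) S ∎

  -- At these arguments the division by `q zero` is exact. The multiplier is general because the
  -- induction calls on `k * q zero` as well as `k`; with `k` = ∏ qᵢ^(aᵢ-1) the argument is `c`.
  count-multiple : ∀ (q : Fin n → ℕ) → (∀ i → Prime (q i)) → Injective _≡_ _≡_ q → ∀ k →
                   count q (k * ∏ℕ q) ≡ k * ∏ℕ (λ i → q i ∸ 1)
  count-multiple {zero} q pq inj k = trans (Σ<-const (k * 1) 1) (*-identityʳ _)
  count-multiple {suc n} q pq inj k = +-cancelʳ-≡ (count (q ∘ suc) (y / q zero)) _ _ (begin
    count q y + count (q ∘ suc) (y / q zero)    ≡⟨ count-suc q pq inj y ⟩
    count (q ∘ suc) y                           ≡⟨ cong (count (q ∘ suc)) (*-assoc k (q zero) Q) ⟨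
    count (q ∘ suc) (k * q zero * Q)            ≡⟨ count-multiple (q ∘ suc) (pq ∘ suc) (suc-injective ∘ inj) (k * q zero) ⟩
    k * q zero * Q-1                            ≡⟨ cong (λ x → k * x * Q-1) (suc-pred (q zero)) ⟨
    k * suc (pred (q zero)) * Q-1               ≡⟨ regroup k (q zero ∸ 1) Q-1 ⟩
    k * ((q zero ∸ 1) * Q-1) + k * Q-1          ≡⟨ cong (λ x → k * ((q zero ∸ 1) * Q-1) + x) (begin
      count (q ∘ suc) (y / q zero)                ≡⟨ cong (count (q ∘ suc)) (trans (cong (_/ q zero) (trans (cong (k *_) (*-comm (q zero) Q)) (sym (*-assoc k Q (q zero))))) (m*n/n≡m (k * Q) (q zero))) ⟩
      count (q ∘ suc) (k * Q)                     ≡⟨ count-multiple (q ∘ suc) (pq ∘ suc) (suc-injective ∘ inj) k ⟩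
      k * Q-1                                     ∎) ⟨
    k * ((q zero ∸ 1) * Q-1) + count (q ∘ suc) (y / q zero) ∎)
    where
    open ≡-Reasoning
    instance
      q₀≢0 : NonZero (q zero)
      q₀≢0 = prime⇒nonZero (pq zero)
    y = k * ∏ℕ q
    Q = ∏ℕ (q ∘ suc)
    Q-1 = ∏ℕ (λ i → q (suc i) ∸ 1)
    regroup : ∀ k p Q → k * suc p * Q ≡ k * (p * Q) + k * Q
    regroup = solve-∀

  length-filter-[1⋯] : ∀ {P : Pred ℕ _} (P? : Decidable P) n → length (filter P? [1⋯ n ]) ≡ Σ< n (λ i → ind (P? (suc i)))
  length-filter-[1⋯] P? zero    = refl
  length-filter-[1⋯] P? (suc n) = begin
    length (filter P? [1⋯ suc n ])                                      ≡⟨ cong (length ∘ filter P?) ([1⋯1+n] n) ⟩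
    length (filter P? ([1⋯ n ] ++ suc n ∷ []))                          ≡⟨ cong length (filter-++ P? [1⋯ n ] _) ⟩
    length (filter P? [1⋯ n ] ++ filter P? (suc n ∷ []))                ≡⟨ length-++ (filter P? [1⋯ n ]) ⟩
    length (filter P? [1⋯ n ]) + length (filter P? (suc n ∷ []))        ≡⟨ cong₂ _+_ (length-filter-[1⋯] P? n) last ⟩
    Σ< (suc n) (λ i → ind (P? (suc i)))                                 ∎
    where
    open ≡-Reasoning
    last : length (filter P? (suc n ∷ [])) ≡ ind (P? (suc n))
    last with P? (suc n)
    ... | yes _ = refl
    ... | no  _ = refl

  χ≤1 : ∀ (q : Fin n → ℕ) m → χ q m ≤ 1
  χ≤1 {zero}  q m = ≤-refl
  χ≤1 {suc n} q m with q zero ∣? m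
  ... | yes _ = z≤n
  ... | no  _ = ≤-trans (≤-reflexive (+-identityʳ _)) (χ≤1 (q ∘ suc) m)

  χ≡0 : ∀ (q : Fin n → ℕ) {m} i → q i ∣ m → χ q m ≡ 0
  χ≡0 q {m} zero    q∣m = cong (_* χ (q ∘ suc) m) (ind-no (¬? (q zero ∣? m)) (λ q∤m → q∤m q∣m))
  χ≡0 q {m} (suc i) q∣m = trans (cong (ind (¬? (q zero ∣? m)) *_) (χ≡0 (q ∘ suc) i q∣m)) (*-zeroʳ (ind (¬? (q zero ∣? m))))

  coprime-* : ∀ {m x y} → Coprime m x → Coprime m y → Coprime m (x * y)
  coprime-* m⊥x m⊥y (d∣m , d∣xy) =
    m⊥y (d∣m , Coprimality.coprime-divisor (λ (e∣d , e∣x) → m⊥x (∣-trans e∣d d∣m , e∣x)) d∣xy)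

  coprime-1 : ∀ {m} → Coprime m 1
  coprime-1 (_ , d∣1) = ∣1⇒≡1 d∣1

  coprime-^ : ∀ {m x} a → Coprime m x → Coprime m (x ^ a)
  coprime-^ zero    m⊥x = coprime-1
  coprime-^ (suc a) m⊥x = coprime-* m⊥x (coprime-^ a m⊥x)

  prime-∤⇒coprime : ∀ {p m} → Prime p → p ∤ m → Coprime m p
  prime-∤⇒coprime pp p∤m (d∣m , d∣p) with prime⇒irreducible pp d∣p
  ... | inj₁ d≡1  = d≡1
  ... | inj₂ refl = contradiction d∣m p∤m

  coprime-∏ : ∀ {m} (x : Fin n → ℕ) → (∀ i → Coprime m (x i)) → Coprime m (∏ℕ x)
  coprime-∏ {zero}  x m⊥x = coprime-1
  coprime-∏ {suc n} x m⊥x = coprime-* (m⊥x zero) (coprime-∏ (x ∘ suc) (m⊥x ∘ suc))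

  ∣-∏⁻ : ∀ {p} → Prime p → (x : Fin n → ℕ) → p ∣ ∏ℕ x → ∃[ i ] p ∣ x i
  ∣-∏⁻ {zero}  pp x p∣1 = contradiction (subst Prime (∣1⇒≡1 p∣1) pp) ¬prime[1]
  ∣-∏⁻ {suc n} pp x p∣∏ with euclidsLemma (x zero) _ pp p∣∏
  ... | inj₁ p∣x₀ = zero , p∣x₀
  ... | inj₂ p∣xs = let i , p∣xᵢ = ∣-∏⁻ pp (x ∘ suc) p∣xs in suc i , p∣xᵢ

  prime-∣-^⇒∣ : ∀ {p x} a → Prime p → p ∣ x ^ a → p ∣ x
  prime-∣-^⇒∣ zero    pp p∣1 = contradiction (subst Prime (∣1⇒≡1 p∣1) pp) ¬prime[1]
  prime-∣-^⇒∣ (suc a) pp p∣ with euclidsLemma _ _ pp p∣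
  ... | inj₁ p∣x  = p∣x
  ... | inj₂ p∣xᵃ = prime-∣-^⇒∣ a pp p∣xᵃ

  ∣-∏⁺ : (x : Fin n → ℕ) → ∀ i → x i ∣ ∏ℕ x
  ∣-∏⁺ x zero    = m∣m*n _
  ∣-∏⁺ x (suc i) = ∣n⇒∣m*n (x zero) (∣-∏⁺ (x ∘ suc) i)

  ∏ℕ-cong : ∀ {x y : Fin n → ℕ} → (∀ i → x i ≡ y i) → ∏ℕ x ≡ ∏ℕ y
  ∏ℕ-cong {zero}  x≡y = refl
  ∏ℕ-cong {suc n} x≡y = cong₂ _*_ (x≡y zero) (∏ℕ-cong (x≡y ∘ suc))

  ∏ℕ-* : ∀ (x y : Fin n → ℕ) → ∏ℕ (λ i → x i * y i) ≡ ∏ℕ x * ∏ℕ y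
  ∏ℕ-* {zero}  x y = refl
  ∏ℕ-* {suc n} x y = trans (cong (x zero * y zero *_) (∏ℕ-* (x ∘ suc) (y ∘ suc))) (interchange (x zero) (y zero) _ _)

  ∏ℕ-tabulate : ∀ (g : ℕ → ℕ) (x : Fin n → ℕ) → product (map g (tabulate x)) ≡ ∏ℕ (g ∘ x)
  ∏ℕ-tabulate {zero}  g x = refl
  ∏ℕ-tabulate {suc n} g x = cong (g (x zero) *_) (∏ℕ-tabulate g (x ∘ suc))

  even-or-odd : ∀ n → (2 ∣ n) ⊎ (2 ∣ suc n)
  even-or-odd zero = inj₁ (2 ∣0)
  even-or-odd (suc n) with even-or-odd n
  ... | inj₁ (divides k eq) = inj₂ (divides (suc k) (cong (λ m → 2 + m) eq))
  ... | inj₂ 2∣1+n = inj₁ 2∣1+n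

  ∏∸1 : List ℕ → ℕ
  ∏∸1 qs = product (map (_∸ 1) qs)

  -- One of two consecutive integers is even, and the only even prime is 2.
  prime-gap : ∀ {p q} → 3 ≤ p → Prime p → Prime q → p < q → p + 2 ≤ q
  prime-gap {p} {q} 3≤p pp pq p<q = subst (_≤ q) (+-comm 2 p) (≤∧≢⇒< p<q 1+p≢q)
    where
    1+p≢q : suc p ≢ q
    1+p≢q 1+p≡q with even-or-odd p
    ... | inj₁ 2∣p   = <⇒≢ 3≤p (prime-∣-prime⇒≡ prime[2] pp 2∣p)
    ... | inj₂ 2∣1+p = <⇒≢ (<-trans 3≤p p<q) (prime-∣-prime⇒≡ prime[2] pq (subst (2 ∣_) 1+p≡q 2∣1+p))

  -- (q / (q − 1))² ≤ q / (q − 2), and the right-hand side telescopes along gaps of length 2.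
  ∏²-odd-primes : ∀ y .{{_ : NonZero y}} {qs} → AllPairs _<_ qs → All Prime qs → All (y + 2 ≤_) qs →
                  product qs ^ 2 * y ≤ ∏∸1 qs ^ 2 * (y + 2 * length qs)
  ∏²-odd-primes y [] [] [] = ≤-reflexive (cong (1 *_) (sym (+-identityʳ y)))
  ∏²-odd-primes y {q ∷ qs} (q<qs ∷ sorted) (pq ∷ pqs) (y+2≤q ∷ _) = begin
    (q * P) ^ 2 * y                                     ≡⟨ regroup₁ q P y ⟩
    -- The prime `q` takes over the role of `y`, its gap hypothesis being `prime-gap`.
    q * y * (P ^ 2 * q)                                 ≤⟨ *-monoʳ-≤ (q * y) (∏²-odd-primes q sorted pqs gaps) ⟩
    q * y * (P-1 ^ 2 * (q + 2 * k))                     ≡⟨ x∙yz≈y∙xz (q * y) (P-1 ^ 2) (q + 2 * k) ⟩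
    P-1 ^ 2 * (q * y * (q + 2 * k))                     ≤⟨ *-monoʳ-≤ (P-1 ^ 2) (step q y+2≤q) ⟩
    P-1 ^ 2 * ((q ∸ 1) ^ 2 * (y + 2 * suc k))           ≡⟨ regroup₂ (q ∸ 1) P-1 (y + 2 * suc k) ⟩
    ((q ∸ 1) * P-1) ^ 2 * (y + 2 * suc k)               ∎
    where
    open ≤-Reasoning
    P = product qs
    P-1 = ∏∸1 qs
    k = length qs
    instance
      q≢0 : NonZero q
      q≢0 = prime⇒nonZero pq
    gaps : All (q + 2 ≤_) qs
    gaps = All.zipWith (λ (q<r , pr) → prime-gap (≤-trans (+-monoˡ-≤ 2 (>-nonZero⁻¹ y)) y+2≤q) pq pr q<r) (q<qs , pqs)
    regroup₁ : ∀ q P y → (q * P) ^ 2 * y ≡ q * y * (P ^ 2 * q)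
    regroup₁ q P y rewrite *-identityʳ (q * P) | *-identityʳ P = lem q P y
      where
      lem : ∀ q P y → q * P * (q * P) * y ≡ q * y * (P * P * q)
      lem = solve-∀
    regroup₂ : ∀ q P y → P ^ 2 * (q ^ 2 * y) ≡ (q * P) ^ 2 * y
    regroup₂ q P y = trans (sym (*-assoc (P ^ 2) (q ^ 2) y)) (cong (_* y) (trans (*-comm (P ^ 2) (q ^ 2)) (sym (^-distribʳ-* 2 q P))))
    q≡1+s : ∀ y z → y + 2 + z ≡ suc (y + 1 + z)
    q≡1+s = solve-∀
    -- With `q = y + 2 + z` the slack is a polynomial with nonnegative coefficients.
    difference : ∀ y z k → (y + 1 + z) * (y + 1 + z) * (y + 2 * suc k)
      ≡ suc (y + 1 + z) * y * (suc (y + 1 + z) + 2 * k)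
      + (2 * k * (1 + z * z + y * z + 2 * z) + y + 2 * y * z + 2 * (1 + z) * (1 + z))
    difference = solve-∀
    step : ∀ q → y + 2 ≤ q → q * y * (q + 2 * k) ≤ (q ∸ 1) ^ 2 * (y + 2 * suc k)
    step q y+2≤q with z , refl ← m≤n⇒∃[o]m+o≡n y+2≤q
      rewrite q≡1+s y z | *-identityʳ (y + 1 + z) =
      ≤-trans (m≤m+n _ _) (≤-reflexive (sym (difference y z k)))

  -- The prime 2 is set apart because 3 follows it too closely; it contributes (2 / 1)² = 4. The odd
  -- primes start the telescope at `y = 1`.
  ∏²-primes : ∀ {qs} → AllPairs _<_ qs → All Prime qs →
              product qs ^ 2 ≤ 4 * (∏∸1 qs ^ 2 * (1 + 2 * length qs))
  ∏²-primes [] [] = s≤s z≤n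
  ∏²-primes {q ∷ qs} sorted@(q<qs ∷ sorted′) (pq ∷ pqs) with q ≟ 2
  ... | yes refl = begin
    (2 * product qs) ^ 2                          ≡⟨ ^-distribʳ-* 2 2 (product qs) ⟩
    4 * product qs ^ 2                            ≡⟨ cong (4 *_) (*-identityʳ (product qs ^ 2)) ⟨
    -- `q<qs` is accepted as the gap hypothesis, since `2 < r` unfolds to `1 + 2 ≤ r`.
    4 * (product qs ^ 2 * 1)                      ≤⟨ *-monoʳ-≤ 4 (∏²-odd-primes 1 sorted′ pqs q<qs) ⟩
    4 * (∏∸1 qs ^ 2 * (1 + 2 * length qs))        ≤⟨ *-monoʳ-≤ 4 (*-mono-≤ (≤-reflexive (cong (_^ 2) (sym (+-identityʳ (∏∸1 qs))))) (+-monoʳ-≤ 1 (*-monoʳ-≤ 2 (n≤1+n (length qs))))) ⟩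
    4 * ((1 * ∏∸1 qs) ^ 2 * (1 + 2 * suc (length qs))) ∎
    where open ≤-Reasoning
  ... | no q≢2 = begin
    product (q ∷ qs) ^ 2                                     ≡⟨ *-identityʳ _ ⟨
    product (q ∷ qs) ^ 2 * 1                                 ≤⟨ ∏²-odd-primes 1 sorted (pq ∷ pqs) (3≤q ∷ All.map (λ q<r → <⇒≤ (≤-<-trans 3≤q q<r)) q<qs) ⟩
    ∏∸1 (q ∷ qs) ^ 2 * (1 + 2 * suc (length qs))             ≤⟨ m≤n*m _ 4 ⟩
    4 * (∏∸1 (q ∷ qs) ^ 2 * (1 + 2 * suc (length qs)))       ∎
    where
    open ≤-Reasoning
    3≤q : 3 ≤ q
    3≤q = ≤∧≢⇒< (nonTrivial⇒n>1 q {{prime⇒nonTrivial pq}}) (q≢2 ∘ sym)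

  m^2≤n^2⇒m≤n : ∀ {m n} → m ^ 2 ≤ n ^ 2 → m ≤ n
  m^2≤n^2⇒m≤n m²≤n² = ≮⇒≥ λ n<m → <⇒≱ (^-monoˡ-< 2 n<m) m²≤n²

  module _ {c : ℕ} (c≥3 : 3 ≤ c) (f : Factorisation c) where
    open Factorisation f

    private
      c≢0 : NonZero c
      c≢0 = >-nonZero (≤-trans (s≤s z≤n) c≥3)

    Ψ : ℕ
    Ψ = ∏ℕ (λ i → q i ^ (a i ∸ 1)) * ∏ℕ (λ i → q i ∸ 1)

    c≡ : c ≡ ∏ℕ (λ i → q i ^ (a i ∸ 1)) * ∏ℕ q
    c≡ = trans c≡∏q^a (trans (∏ℕ-cong factor) (∏ℕ-* _ q))
      where
      factor : ∀ i → q i ^ a i ≡ q i ^ (a i ∸ 1) * q i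
      factor i = trans (cong (q i ^_) (sym (m+[n∸m]≡n (a≥1 i)))) (*-comm (q i) _)

    count-c≡Ψ : count q c ≡ Ψ
    count-c≡Ψ = trans (cong (count q) c≡) (count-multiple q q-prime q-distinct (∏ℕ (λ i → q i ^ (a i ∸ 1))))

    -- A number missed by every prime `q i` is coprime to each prime power and so to `c`. Summation
    -- over `m ≤ c` then compares `Ψ` with `φ c`.
    χ≤ind-coprime : ∀ m → χ q m ≤ ind (coprime? m c)
    χ≤ind-coprime m with any? (λ i → q i ∣? m)
    ... | yes (i , qᵢ∣m) = ≤-trans (≤-reflexive (χ≡0 q i qᵢ∣m)) z≤n
    ... | no  q∤m = ≤-trans (χ≤1 q m) (≤-reflexive (sym (ind-yes (coprime? m c) m⊥c)))
      where
      m⊥c : Coprime m c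
      m⊥c = subst (Coprime m) (sym c≡∏q^a)
        (coprime-∏ _ λ i → coprime-^ (a i) (prime-∤⇒coprime (q-prime i) λ qᵢ∣m → q∤m (i , qᵢ∣m)))

    Ψ≤φ : Ψ ≤ φ c
    Ψ≤φ = begin
      Ψ                                          ≡⟨ count-c≡Ψ ⟨
      count q c                                  ≤⟨ Σ<-mono c (λ i → χ≤ind-coprime (suc i)) ⟩
      Σ< c (λ i → ind (coprime? (suc i) c))      ≡⟨ length-filter-[1⋯] (λ k → coprime? k c) c ⟨
      φ c                                        ∎
      where open ≤-Reasoning

    -- Since `c / (q i * m)` is `c / q i / m`, this is Legendre's formula at `c / q i`.
    E≡count : ∀ i → E (q i) ≡ + count q ((c / q i) {{q≢0 {i}}})
    E≡count i = trans (cong (List.foldr ℤ._+_ 0ℤ) (map-cong (λ S → cong (λ k → -1ℤ ℤ.^ ∣ S ∣ ℤ.* + k)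
        (sym (m/n/o≡m/[n*o] c (q i) (∏ₛ q S) {{q≢0 {i}}} {{∏ₛ≢0 q q≢0′ S}} {{m*n≢0 (q i) (∏ₛ q S) {{q≢0 {i}}} {{∏[]q≢0 S}}}}))) (subsets ω)))
      (legendre q q-prime q-distinct q≢0′ _)
      where
      q≢0′ : ∀ i → NonZero (q i)
      q≢0′ i = q≢0 {i}

    -- The `q i` come in any order, while the gap argument needs increasing primes. The permutation
    -- carries products and the length `ω` across.
    primeDivisors-↭ : primeDivisors c ↭ tabulate q
    primeDivisors-↭ = Unique-⊆⊇⇒↭ (Unique.tabulate⁺ q-distinct) (sorted⇒Unique (primeDivisors-sorted c)) to from
      where
      to : ∀ {p} → p ∈ tabulate q → p ∈ primeDivisors c
      to p∈ with i , refl ← ∈-tabulate⁻ p∈ = ∈-primeDivisors⁺ {{c≢0}} (q-prime i)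
        (subst (q i ∣_) (sym c≡) (∣n⇒∣m*n (∏ℕ (λ i → q i ^ (a i ∸ 1))) (∣-∏⁺ q i)))
      from : ∀ {p} → p ∈ primeDivisors c → p ∈ tabulate q
      from p∈ with pp , p∣c ← ∈-primeDivisors⁻ {{c≢0}} p∈
        with i , p∣qᵃ ← ∣-∏⁻ pp _ (subst (_ ∣_) c≡∏q^a p∣c) =
        subst (_∈ tabulate q) (sym (prime-∣-prime⇒≡ pp (q-prime i) (prime-∣-^⇒∣ (a i) pp p∣qᵃ))) (∈-tabulate⁺ i)

    product-primeDivisors : ∀ g → product (map g (primeDivisors c)) ≡ ∏ℕ (g ∘ q)
    product-primeDivisors g = trans (product-↭ (↭-map⁺ g primeDivisors-↭)) (∏ℕ-tabulate g q)

    R≡∏q : R c ≡ ∏ℕ q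
    R≡∏q = trans (cong product (sym (map-id (primeDivisors c)))) (product-primeDivisors id)

    c²≤ : c ^ 2 ≤ Ψ ^ 2 * (4 * (1 + 2 * ω))
    c²≤ = begin
      c ^ 2                                       ≡⟨ cong (_^ 2) c≡ ⟩
      (K * ∏ℕ q) ^ 2                              ≡⟨ ^-distribʳ-* 2 K (∏ℕ q) ⟩
      K ^ 2 * ∏ℕ q ^ 2                            ≡⟨ cong (λ r → K ^ 2 * r ^ 2) R≡∏q ⟨
      K ^ 2 * R c ^ 2                             ≤⟨ *-monoʳ-≤ (K ^ 2) (∏²-primes (primeDivisors-sorted c) (All.tabulate λ p∈ → proj₁ (∈-primeDivisors⁻ {{c≢0}} p∈))) ⟩
      K ^ 2 * (4 * (∏∸1 ps ^ 2 * (1 + 2 * length ps))) ≡⟨ cong₂ (λ r l → K ^ 2 * (4 * (r ^ 2 * (1 + 2 * l)))) (product-primeDivisors (_∸ 1)) (trans (↭-length primeDivisors-↭) (length-tabulate q)) ⟩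
      K ^ 2 * (4 * (P-1 ^ 2 * (1 + 2 * ω)))       ≡⟨ cong (K ^ 2 *_) (x∙yz≈y∙xz 4 (P-1 ^ 2) _) ⟩
      K ^ 2 * (P-1 ^ 2 * (4 * (1 + 2 * ω)))       ≡⟨ *-assoc (K ^ 2) (P-1 ^ 2) _ ⟨
      K ^ 2 * P-1 ^ 2 * (4 * (1 + 2 * ω))         ≡⟨ cong (_* (4 * (1 + 2 * ω))) (^-distribʳ-* 2 K P-1) ⟨
      Ψ ^ 2 * (4 * (1 + 2 * ω))                   ∎
      where
      open ≤-Reasoning
      ps = primeDivisors c
      K = ∏ℕ (λ i → q i ^ (a i ∸ 1))
      P-1 = ∏ℕ (λ i → q i ∸ 1)

    8c≤ : 8 * c ≤ φ c * (ω + 256)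
    8c≤ = m^2≤n^2⇒m≤n (begin
      (8 * c) ^ 2                          ≡⟨ ^-distribʳ-* 2 8 c ⟩
      64 * c ^ 2                           ≤⟨ *-monoʳ-≤ 64 c²≤ ⟩
      64 * (Ψ ^ 2 * (4 * (1 + 2 * ω)))     ≡⟨ x∙yz≈y∙xz 64 (Ψ ^ 2) _ ⟩
      Ψ ^ 2 * (64 * (4 * (1 + 2 * ω)))     ≤⟨ *-mono-≤ (^-monoˡ-≤ 2 Ψ≤φ) (am-gm ω) ⟩
      φ c ^ 2 * (ω + 256) ^ 2              ≡⟨ ^-distribʳ-* 2 (φ c) (ω + 256) ⟨
      (φ c * (ω + 256)) ^ 2                ∎)
      where
      open ≤-Reasoning
      expand : ∀ w → (w + 256) * (w + 256) ≡ 64 * (4 * (1 + 2 * w)) + (w * w + 65280)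
      expand = solve-∀
      -- 256 is the constant for which the cross term `512 * w` of the square equals the linear term
      -- on the left.
      am-gm : ∀ w → 64 * (4 * (1 + 2 * w)) ≤ (w + 256) ^ 2
      am-gm w rewrite *-identityʳ (w + 256) = ≤-trans (m≤m+n _ (w * w + 65280)) (≤-reflexive (sym (expand w)))

-- The inequality in ℕ, with all roots and denominators cleared.

module NaturalBound where
  open Totatives
  open Sieve
  open ListProducts
  open import Defs using (R; φ; G; G≢0; ∏ℕ; Factorisation)
  open import Data.List.Base using (map)
  open import Data.Nat.Base
  open import Data.Nat.ListAction using (product)
  open import Data.Nat.Properties
  open import Data.Nat.Tactic.RingSolver using (solve-∀)
  open import Relation.Binary.PropositionalEquality

  module _ {c : ℕ} (c≥3 : 3 ≤ c) (f : Factorisation c) where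
    open Factorisation f

    -- One factor `q i` is split off from each odd power and the rest is a square. The φ-th power
    -- thus has the shape R^φ (Ψ^φ)², matching `G-lower`.
    ∏≡R*Ψ² : ∏ℕ (λ i → q i ^ (2 * a i ∸ 1) * (q i ∸ 1) ^ 2) ≡ R c * Ψ c≥3 f ^ 2
    ∏≡R*Ψ² = begin
      ∏ℕ (λ i → q i ^ (2 * a i ∸ 1) * (q i ∸ 1) ^ 2)     ≡⟨ ∏ℕ-cong (λ i → factor (q i) (a i) (q i ∸ 1) (a≥1 i)) ⟩
      ∏ℕ (λ i → q i * (y i * y i))                       ≡⟨ ∏ℕ-* q (λ i → y i * y i) ⟩
      ∏ℕ q * ∏ℕ (λ i → y i * y i)                        ≡⟨ cong₂ _*_ (sym (R≡∏q c≥3 f)) (∏ℕ-* y y) ⟩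
      R c * (∏ℕ y * ∏ℕ y)                                ≡⟨ cong (λ z → R c * (∏ℕ y * z)) (*-identityʳ (∏ℕ y)) ⟨
      R c * ∏ℕ y ^ 2                                     ≡⟨ cong (λ z → R c * z ^ 2) (∏ℕ-* (λ i → q i ^ (a i ∸ 1)) (λ i → q i ∸ 1)) ⟩
      R c * Ψ c≥3 f ^ 2                                  ∎
      where
      open ≡-Reasoning
      y = λ i → q i ^ (a i ∸ 1) * (q i ∸ 1)
      regroup : ∀ q z p → q * (z * z) * (p * p) ≡ q * (z * p * (z * p))
      regroup = solve-∀
      factor : ∀ q a p → 1 ≤ a → q ^ (2 * a ∸ 1) * p ^ 2 ≡ q * (q ^ (a ∸ 1) * p * (q ^ (a ∸ 1) * p))
      factor q (suc a) p _ = begin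
        q ^ (a + suc (a + 0)) * (p * (p * 1))   ≡⟨ cong₂ (λ e r → q ^ e * (p * r)) (trans (+-suc a (a + 0)) (cong (λ b → suc (a + b)) (+-identityʳ a))) (*-identityʳ p) ⟩
        q * q ^ (a + a) * (p * p)               ≡⟨ cong (λ r → q * r * (p * p)) (^-distribˡ-+-* q a a) ⟩
        q * (q ^ a * q ^ a) * (p * p)           ≡⟨ regroup q (q ^ a) p ⟩
        q * (q ^ a * p * (q ^ a * p))           ∎

    -- The exponent is ω + 259 and not 259 + ω, since 4 ^ (259 + ω) would be unfolded by the type checker.
    ∏^φ<G² : ∏ℕ (λ i → q i ^ (2 * a i ∸ 1) * (q i ∸ 1) ^ 2) ^ φ c < G c ^ 2 * (4 ^ (ω + 259)) ^ φ c
    ∏^φ<G² = begin-strict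
      ∏ℕ (λ i → q i ^ (2 * a i ∸ 1) * (q i ∸ 1) ^ 2) ^ φ c  ≡⟨ cong (_^ φ c) ∏≡R*Ψ² ⟩
      (R c * Ψ c≥3 f ^ 2) ^ φ c                        ≤⟨ ^-monoˡ-≤ (φ c) (*-monoʳ-≤ (R c) (^-monoˡ-≤ 2 (Ψ≤φ c≥3 f))) ⟩
      (R c * φ c ^ 2) ^ φ c                            ≡⟨ ^-distribʳ-* (φ c) (R c) (φ c ^ 2) ⟩
      r * (φ c ^ 2) ^ φ c                              ≡⟨ cong (r *_) (trans (^-*-assoc (φ c) 2 (φ c)) (trans (cong (φ c ^_) (*-comm 2 (φ c))) (sym (^-*-assoc (φ c) (φ c) 2)))) ⟩
      r * (φ c ^ φ c) ^ 2                              ≤⟨ *-monoʳ-≤ r (^-monoˡ-≤ 2 (φ^φ≤ c)) ⟩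
      r * (4 ^ φ c * (P * 4 ^ (4 * c))) ^ 2            ≡⟨ cong (r *_) (trans (^-distribʳ-* 2 (4 ^ φ c) _) (cong ((4 ^ φ c) ^ 2 *_) (^-distribʳ-* 2 P (4 ^ (4 * c))))) ⟩
      r * ((4 ^ φ c) ^ 2 * (P ^ 2 * (4 ^ (4 * c)) ^ 2)) ≡⟨ regroup r ((4 ^ φ c) ^ 2) (P ^ 2) ((4 ^ (4 * c)) ^ 2) ⟩
      P ^ 2 * r * ((4 ^ φ c) ^ 2 * (4 ^ (4 * c)) ^ 2)  ≡⟨ cong (P ^ 2 * r *_) powers ⟩
      -- The bound on `8 * c` makes the exponent of 4 a multiple of φ, so that the error is again a
      -- φ-th power.
      P ^ 2 * r * 4 ^ (φ c * 2 + 8 * c)                ≤⟨ *-mono-≤ (G-lower c≥3) (^-monoʳ-≤ 4 exponents) ⟩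
      G c ^ 2 * 4 ^ ((ω + 258) * φ c)                  ≡⟨ cong (G c ^ 2 *_) (^-*-assoc 4 (ω + 258) (φ c)) ⟨
      G c ^ 2 * (4 ^ (ω + 258)) ^ φ c                  <⟨ *-monoʳ-< (G c ^ 2) (^-monoˡ-< (φ c) (^-monoʳ-< 4 (s≤s (s≤s z≤n)) (+-monoʳ-< ω (n<1+n 258)))) ⟩
      G c ^ 2 * (4 ^ (ω + 259)) ^ φ c                  ∎
      where
      open ≤-Reasoning
      r = R c ^ φ c
      P = product (map R (totatives c))
      instance
        G²≢0 : NonZero (G c ^ 2)
        G²≢0 = m^n≢0 (G c) 2 {{G≢0 c}}
      regroup : ∀ r f p b → r * (f * (p * b)) ≡ p * r * (f * b)
      regroup = solve-∀
      powers : (4 ^ φ c) ^ 2 * (4 ^ (4 * c)) ^ 2 ≡ 4 ^ (φ c * 2 + 8 * c)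
      powers = trans (cong₂ _*_ (^-*-assoc 4 (φ c) 2) (trans (^-*-assoc 4 (4 * c) 2) (cong (4 ^_) (double c))))
        (sym (^-distribˡ-+-* 4 (φ c * 2) (8 * c)))
        where
        double : ∀ c → 4 * c * 2 ≡ 8 * c
        double = solve-∀
      exponents : φ c * 2 + 8 * c ≤ (ω + 258) * φ c
      exponents = ≤-trans (+-monoʳ-≤ (φ c * 2) (8c≤ c≥3 f)) (≤-reflexive (collect (φ c) ω))
        where
        collect : ∀ f w → f * 2 + f * (w + 256) ≡ (w + 258) * f
        collect = solve-∀

-- Comparing roots through rational bounds.

module RadicalOrder where
  open Totatives using (^-distribʳ-*)
  open import Defs
  open import Data.Fin.Base using (Fin; zero; suc)
  open import Data.Integer.Base as ℤ using (ℤ; +_; -[1+_])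
  import Data.Integer.Properties as ℤ
  open import Data.Nat.Base as ℕ using (ℕ; zero; suc; NonZero; _∸_)
  import Data.Nat.Properties as ℕ
  open import Data.Rational.Base as ℚ using (ℚ; mkℚ; 1ℚ; _/_; ↥_; ↧ₙ_; 1/_; Positive; NonNegative; toℚᵘ; _≤_)
  open import Data.Rational.Properties as ℚ using (pos⇒nonNeg; pos⇒nonZero; pos*pos⇒pos; 1/pos⇒pos; toℚᵘ-injective; toℚᵘ-fromℚᵘ; toℚᵘ-homo-*; toℚᵘ-homo-+)
  open import Data.Rational.Unnormalised.Base as ℚᵘ using (ℚᵘ; mkℚᵘ; *≡*; *≤*; *<*)
  import Data.Rational.Unnormalised.Properties as ℚᵘ
  import Algebra.Definitions.RawSemiring ℚ.+-*-rawSemiring as ℚPow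
  open import Algebra.Bundles using (CommutativeRing)
  import Algebra.Properties.CommutativeSemiring.Exp (CommutativeRing.commutativeSemiring ℚ.+-*-commutativeRing) as Exp
  import Data.Vec.Functional as Vector
  open import Function.Base using (_∘_)
  open import Relation.Binary.PropositionalEquality
  open import Relation.Nullary.Negation using (contradiction)

  *-mono-≤ : ∀ {p q r s} .{{_ : Positive q}} .{{_ : Positive r}} → p ≤ q → r ≤ s → p ℚ.* r ≤ q ℚ.* s
  *-mono-≤ {q = q} {r} p≤q r≤s =
    ℚ.≤-trans (ℚ.*-monoʳ-≤-nonNeg r {{pos⇒nonNeg r}} p≤q) (ℚ.*-monoˡ-≤-nonNeg q {{pos⇒nonNeg q}} r≤s)

  ^-mono-≤ : ∀ {p q} .{{_ : Positive p}} .{{_ : Positive q}} n → p ≤ q → p ℚPow.^ n ≤ q ℚPow.^ n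
  ^-mono-≤ zero p≤q = ℚ.≤-refl
  ^-mono-≤ {p} {q} {{_}} {{q>0}} (suc n) p≤q = *-mono-≤ {{q>0}} {{^-pos p n}} p≤q (^-mono-≤ n p≤q)

  ^-mono-< : ∀ {p q} .{{_ : Positive p}} .{{_ : Positive q}} n .{{_ : NonZero n}} → p ℚ.< q → p ℚPow.^ n ℚ.< q ℚPow.^ n
  ^-mono-< {p} {q} (suc n) p<q = ℚ.<-≤-trans
    (ℚ.*-monoˡ-<-pos (p ℚPow.^ n) {{^-pos p n}} p<q)
    (ℚ.*-monoˡ-≤-nonNeg q {{pos⇒nonNeg q}} (^-mono-≤ n (ℚ.<⇒≤ p<q)))

  ^-cancel-< : ∀ {p q} .{{_ : Positive p}} .{{_ : Positive q}} n → p ℚPow.^ n ℚ.< q ℚPow.^ n → p ℚ.< q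
  ^-cancel-< n pⁿ<qⁿ = ℚ.≰⇒> λ q≤p → ℚ.<-irrefl refl (ℚ.<-≤-trans pⁿ<qⁿ (^-mono-≤ n q≤p))

  1≤^ : ∀ {p} .{{_ : Positive p}} n → 1ℚ ≤ p → 1ℚ ≤ p ℚPow.^ n
  1≤^ zero    1≤p = ℚ.≤-refl
  1≤^ (suc n) 1≤p = *-mono-≤ 1≤p (1≤^ n 1≤p)

  ^-monoʳ-≤ : ∀ {p} .{{_ : Positive p}} {m n} → 1ℚ ≤ p → m ℕ.≤ n → p ℚPow.^ m ≤ p ℚPow.^ n
  ^-monoʳ-≤ {p} {n = n} 1≤p ℕ.z≤n       = 1≤^ n 1≤p
  ^-monoʳ-≤ {p}         1≤p (ℕ.s≤s m≤n) = ℚ.*-monoˡ-≤-nonNeg p {{pos⇒nonNeg p}} (^-monoʳ-≤ 1≤p m≤n)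

  ^-swap : ∀ p m n → (p ℚPow.^ m) ℚPow.^ n ≡ (p ℚPow.^ n) ℚPow.^ m
  ^-swap p m n = trans (Exp.^-assocʳ p m n) (trans (cong (p ℚPow.^_) (ℕ.*-comm m n)) (sym (Exp.^-assocʳ p n m)))

  1^ : ∀ n → 1ℚ ℚPow.^ n ≡ 1ℚ
  1^ zero    = refl
  1^ (suc n) = trans (ℚ.*-identityˡ _) (1^ n)

  -- For nonzero `n` this is the radicand of `nat n`.
  ι : ℕ → ℚ
  ι n = + n / 1

  -- `_/_` reduces to lowest terms, so the identity is checked on unnormalised fractions, where
  -- equality is cross-multiplication.
  ι-* : ∀ m n → ι (m ℕ.* n) ≡ ι m ℚ.* ι n
  ι-* m n = toℚᵘ-injective (begin
    toℚᵘ (ι (m ℕ.* n))              ≈⟨ toℚᵘ-fromℚᵘ (mkℚᵘ (+ (m ℕ.* n)) 0) ⟩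
    mkℚᵘ (+ (m ℕ.* n)) 0            ≈⟨ *≡* (cong (ℤ._* + 1) (ℤ.pos-* m n)) ⟩
    mkℚᵘ (+ m) 0 ℚᵘ.* mkℚᵘ (+ n) 0  ≈⟨ ℚᵘ.*-cong (toℚᵘ-fromℚᵘ (mkℚᵘ (+ m) 0)) (toℚᵘ-fromℚᵘ (mkℚᵘ (+ n) 0)) ⟨
    toℚᵘ (ι m) ℚᵘ.* toℚᵘ (ι n)      ≈⟨ toℚᵘ-homo-* (ι m) (ι n) ⟨
    toℚᵘ (ι m ℚ.* ι n)              ∎)
    where open ℚᵘ.≃-Reasoning

  ι-+ : ∀ m n → ι (m ℕ.+ n) ≡ ι m ℚ.+ ι n
  ι-+ m n = toℚᵘ-injective (begin
    toℚᵘ (ι (m ℕ.+ n))              ≈⟨ toℚᵘ-fromℚᵘ (mkℚᵘ (+ (m ℕ.+ n)) 0) ⟩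
    mkℚᵘ (+ (m ℕ.+ n)) 0            ≈⟨ *≡* (cong (λ i → i ℤ.* + 1) (trans (ℤ.pos-+ m n) (sym (cong₂ ℤ._+_ (ℤ.*-identityʳ (+ m)) (ℤ.*-identityʳ (+ n)))))) ⟩
    mkℚᵘ (+ m) 0 ℚᵘ.+ mkℚᵘ (+ n) 0  ≈⟨ ℚᵘ.+-cong (toℚᵘ-fromℚᵘ (mkℚᵘ (+ m) 0)) (toℚᵘ-fromℚᵘ (mkℚᵘ (+ n) 0)) ⟨
    toℚᵘ (ι m) ℚᵘ.+ toℚᵘ (ι n)      ≈⟨ toℚᵘ-homo-+ (ι m) (ι n) ⟨
    toℚᵘ (ι m ℚ.+ ι n)              ∎)
    where open ℚᵘ.≃-Reasoning

  ι-^ : ∀ m n → ι (m ℕ.^ n) ≡ ι m ℚPow.^ n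
  ι-^ m zero    = refl
  ι-^ m (suc n) = trans (ι-* m (m ℕ.^ n)) (cong (ι m ℚ.*_) (ι-^ m n))

  ι-mono-≤ : ∀ {m n} → m ℕ.≤ n → ι m ≤ ι n
  ι-mono-≤ {m} {n} m≤n = ℚ.toℚᵘ-cancel-≤ (ℚᵘ.≤-respˡ-≃ (ℚᵘ.≃-sym (toℚᵘ-fromℚᵘ (mkℚᵘ (+ m) 0)))
    (ℚᵘ.≤-respʳ-≃ (ℚᵘ.≃-sym (toℚᵘ-fromℚᵘ (mkℚᵘ (+ n) 0))) (*≤* (ℤ.*-monoʳ-≤-nonNeg (+ 1) (ℤ.+≤+ m≤n)))))

  ι-mono-< : ∀ {m n} → m ℕ.< n → ι m ℚ.< ι n
  ι-mono-< {m} {n} m<n = ℚ.toℚᵘ-cancel-< (ℚᵘ.<-respˡ-≃ (ℚᵘ.≃-sym (toℚᵘ-fromℚᵘ (mkℚᵘ (+ m) 0)))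
    (ℚᵘ.<-respʳ-≃ (ℚᵘ.≃-sym (toℚᵘ-fromℚᵘ (mkℚᵘ (+ n) 0))) (*<* (ℤ.*-monoʳ-<-pos (+ 1) (ℤ.+<+ m<n)))))

  /-*-ι : ∀ m n .{{_ : NonZero n}} → (+ m / n) ℚ.* ι n ≡ ι m
  /-*-ι m n@(suc n-1) = toℚᵘ-injective (begin
    toℚᵘ ((+ m / n) ℚ.* ι n)             ≈⟨ toℚᵘ-homo-* (+ m / n) (ι n) ⟩
    toℚᵘ (+ m / n) ℚᵘ.* toℚᵘ (ι n)       ≈⟨ ℚᵘ.*-cong (toℚᵘ-fromℚᵘ (mkℚᵘ (+ m) n-1)) (toℚᵘ-fromℚᵘ (mkℚᵘ (+ n) 0)) ⟩
    mkℚᵘ (+ m) n-1 ℚᵘ.* mkℚᵘ (+ n) 0     ≈⟨ *≡* (trans (ℤ.*-identityʳ _) (cong (λ k → + m ℤ.* + k) (sym (ℕ.*-identityʳ n)))) ⟩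
    mkℚᵘ (+ m) 0                         ≈⟨ toℚᵘ-fromℚᵘ (mkℚᵘ (+ m) 0) ⟨
    toℚᵘ (ι m)                           ∎)
    where open ℚᵘ.≃-Reasoning

  infix 4 _≼_

  -- The real number x is at most `s`. On the right-hand side of the theorem only the exponents with
  -- `E` create roots, so a rational bound on each factor brings the whole product back to ℚ.
  _≼_ : Radical → ℚ → Set
  (m √ r) ≼ s = r ≤ s ℚPow.^ m

  ≼-* : ∀ x y {s t} .{{_ : Positive s}} .{{_ : Positive t}} → x ≼ s → y ≼ t → x * y ≼ s ℚ.* t
  ≼-* (_√_ m r {{_}} {{r>0}}) (_√_ n r′ {{_}} {{r′>0}}) {s} {t} r≤sᵐ r′≤tⁿ = begin
    r ℚPow.^ n ℚ.* r′ ℚPow.^ m                        ≤⟨ *-mono-≤ {{^-pos (s ℚPow.^ m) {{^-pos s m}} n}} {{^-pos r′ m}} (^-mono-≤ {{r>0}} {{^-pos s m}} n r≤sᵐ) (^-mono-≤ {{r′>0}} {{^-pos t n}} m r′≤tⁿ) ⟩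
    (s ℚPow.^ m) ℚPow.^ n ℚ.* (t ℚPow.^ n) ℚPow.^ m   ≡⟨ cong₂ ℚ._*_ (Exp.^-assocʳ s m n) (trans (^-swap t n m) (Exp.^-assocʳ t m n)) ⟩
    s ℚPow.^ (m ℕ.* n) ℚ.* t ℚPow.^ (m ℕ.* n)         ≡⟨ Exp.^-distrib-* s t (m ℕ.* n) ⟨
    (s ℚ.* t) ℚPow.^ (m ℕ.* n)                        ∎
    where open ℚ.≤-Reasoning

  ∏ℚ : ∀ {n} → (Fin n → ℚ) → ℚ
  ∏ℚ = Vector.foldr ℚ._*_ 1ℚ

  ∏ℚ-pos : ∀ {n} (s : Fin n → ℚ) → (∀ i → Positive (s i)) → Positive (∏ℚ s)
  ∏ℚ-pos {zero}  s s>0 = _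
  ∏ℚ-pos {suc n} s s>0 = pos*pos⇒pos (s zero) {{s>0 zero}} (∏ℚ (s ∘ suc)) {{∏ℚ-pos (s ∘ suc) (s>0 ∘ suc)}}

  ≼-∏ : ∀ {n} (x : Fin n → Radical) (s : Fin n → ℚ) → (∀ i → Positive (s i)) → (∀ i → x i ≼ s i) → ∏ x ≼ ∏ℚ s
  ≼-∏ {zero}  x s s>0 x≼s = ℚ.≤-refl
  ≼-∏ {suc n} x s s>0 x≼s = ≼-* (x zero) (∏ (x ∘ suc)) {{s>0 zero}} {{∏ℚ-pos (s ∘ suc) (s>0 ∘ suc)}}
    (x≼s zero) (≼-∏ (x ∘ suc) (s ∘ suc) (s>0 ∘ suc) (x≼s ∘ suc))

  -- The integer exponent may be negative, in which case the left side is at most 1 and the right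
  -- side at least 1.
  ^ℤ-≤-^ : ∀ {r} .{{_ : Positive r}} z k → 1ℚ ≤ r → z ℤ.≤ + k → r ^ℤ z ≤ r ℚPow.^ k
  ^ℤ-≤-^ (+ n) k 1≤r (ℤ.+≤+ n≤k) = ^-monoʳ-≤ 1≤r n≤k
  ^ℤ-≤-^ {r} -[1+ n ] k 1≤r _ = ℚ.≤-trans (subst (r⁻¹ ℚPow.^ suc n ≤_) (1^ (suc n)) (^-mono-≤ {{r⁻¹>0}} (suc n) r⁻¹≤1)) (1≤^ k 1≤r)
    where
    instance
      r≢0 : ℚ.NonZero r
      r≢0 = pos⇒nonZero r
    r⁻¹ = 1/ r
    r⁻¹>0 : Positive r⁻¹
    r⁻¹>0 = 1/pos⇒pos r
    r⁻¹≤1 : r⁻¹ ≤ 1ℚ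
    r⁻¹≤1 = subst₂ _≤_ (ℚ.*-identityʳ r⁻¹) (ℚ.*-inverseˡ r) (ℚ.*-monoˡ-≤-nonNeg r⁻¹ {{pos⇒nonNeg r⁻¹ {{r⁻¹>0}}}} 1≤r)

  -- In terms of numerator and denominator, `e ≤ ι k` says `↥ e ≤ k * ↧ₙ e`, and powers of `q ≥ 1`
  -- grow with the exponent. Opening `e` as a record lets `_^_` compute.
  nat-^-≼ : ∀ q .{{_ : NonZero q}} e k → e ≤ ι k → nat q ^ e ≼ ι q ℚPow.^ k
  nat-^-≼ q e@record{} k e≤k = subst (λ m → ι q ^ℤ ↥ e ≤ (ι q ℚPow.^ k) ℚPow.^ m) (sym (ℕ.*-identityˡ (↧ₙ e)))
    (subst (ι q ^ℤ ↥ e ≤_) (sym (Exp.^-assocʳ (ι q) k (↧ₙ e)))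
      (^ℤ-≤-^ (↥ e) (k ℕ.* ↧ₙ e) (ι-mono-≤ (ℕ.>-nonZero⁻¹ q)) ↥e≤))
    where
    instance
      ιq>0 : Positive (ι q)
      ιq>0 = /-pos q 1
    ↥e≤ : ↥ e ℤ.≤ + (k ℕ.* ↧ₙ e)
    ↥e≤ with *≤* le ← ℚᵘ.≤-respʳ-≃ (toℚᵘ-fromℚᵘ (mkℚᵘ (+ k) 0)) (ℚ.toℚᵘ-mono-≤ e≤k) =
      subst₂ ℤ._≤_ (ℤ.*-identityʳ (↥ e)) (sym (ℤ.pos-* k (↧ₙ e))) le

  ι-∸1 : ∀ k → 1 ℕ.≤ k → ι k ℚ.- 1ℚ ≡ ι (k ∸ 1)
  ι-∸1 (suc k) _ = begin
    ι (1 ℕ.+ k) ℚ.- 1ℚ          ≡⟨ cong (ℚ._- 1ℚ) (trans (cong ι (ℕ.+-comm 1 k)) (ι-+ k 1)) ⟩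
    ι k ℚ.+ 1ℚ ℚ.- 1ℚ           ≡⟨ ℚ.+-assoc (ι k) 1ℚ (ℚ.- 1ℚ) ⟩
    ι k ℚ.+ (1ℚ ℚ.- 1ℚ)         ≡⟨ ℚ.+-identityʳ (ι k) ⟩
    ι k                         ∎
    where open ≡-Reasoning

  p-nonNeg≤p : ∀ p q .{{_ : NonNegative q}} → p ℚ.- q ≤ p
  p-nonNeg≤p p q = subst (p ℚ.- q ≤_) (ℚ.+-identityʳ p) (ℚ.+-monoʳ-≤ p (ℚ.neg-antimono-≤ (ℚ.nonNegative⁻¹ q)))

  ι-nonNeg : ∀ n → NonNegative (ι n)
  ι-nonNeg n = ℚ.normalize-nonNeg n 1

  -- `+ m / n` is stored in lowest terms u / d, known only through `u * n ≡ m * d`; this equality of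
  -- exponents is all that is used.
  ^-/-radicand : ∀ g .{{_ : Positive g}} m n .{{_ : NonZero n}} → let e = + m / n in
                 (g ^ℤ ↥ e) ℚPow.^ n ≡ (g ℚPow.^ m) ℚPow.^ ↧ₙ e
  ^-/-radicand g m n@(suc n-1) with + m / n | toℚᵘ-fromℚᵘ (mkℚᵘ (+ m) n-1)
  ... | mkℚ (+ u) d-1 _ | *≡* eq = trans (Exp.^-assocʳ g u n) (trans (cong (g ℚPow.^_) un≡) (sym (Exp.^-assocʳ g m (suc d-1))))
    where
    un≡ : u ℕ.* n ≡ m ℕ.* suc d-1
    un≡ = ℤ.+-injective (trans (ℤ.pos-* u n) (trans eq (sym (ℤ.pos-* m (suc d-1)))))
  -- A negative numerator contradicts `m ≥ 0`.
  ... | mkℚ -[1+ u ] d-1 _ | *≡* eq = contradiction (trans eq (sym (ℤ.pos-* m (suc d-1)))) λ ()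

  -- The chain is x ≤ s < g^(m / n), its second half being tested on n-th powers. `+ m / n` is
  -- abstracted together with its radicand equation so that `_^_` can reduce.
  ≼⇒< : ∀ x g .{{_ : NonZero g}} m n .{{_ : NonZero n}} s .{{_ : Positive s}} →
        x ≼ s → s ℚPow.^ n ℚ.< ι g ℚPow.^ m → x < nat g ^ (+ m / n)
  ≼⇒< (_√_ i r {{_}} {{r>0}}) g m n s r≤sⁱ sⁿ<gᵐ with + m / n | ^-/-radicand (ι g) {{/-pos g 1}} m n
  ... | e@record{} | radicandⁿ = begin-strict
    r ℚPow.^ (1 ℕ.* ↧ₙ e)            ≡⟨ cong (r ℚPow.^_) (ℕ.*-identityˡ (↧ₙ e)) ⟩
    r ℚPow.^ ↧ₙ e                    ≤⟨ ^-mono-≤ {{r>0}} {{^-pos s i}} (↧ₙ e) r≤sⁱ ⟩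
    (s ℚPow.^ i) ℚPow.^ ↧ₙ e         ≡⟨ ^-swap s i (↧ₙ e) ⟩
    (s ℚPow.^ ↧ₙ e) ℚPow.^ i         <⟨ ^-mono-< {{^-pos s (↧ₙ e)}} {{γ>0}} i s^e<γ ⟩
    γ ℚPow.^ i                       ∎
    where
    open ℚ.≤-Reasoning
    instance
      ιg>0 : Positive (ι g)
      ιg>0 = /-pos g 1
    γ = ι g ^ℤ ↥ e
    γ>0 : Positive γ
    γ>0 = ^ℤ-pos (ι g) (↥ e)
    s^e<γ : s ℚPow.^ ↧ₙ e ℚ.< γ
    s^e<γ = ^-cancel-< {{^-pos s (↧ₙ e)}} {{γ>0}} n
      (subst₂ ℚ._<_ (^-swap s n (↧ₙ e)) (sym radicandⁿ)
        (^-mono-< {{^-pos s n}} {{^-pos (ι g) m}} (↧ₙ e) sⁿ<gᵐ))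

open import Defs
open import Data.Integer.Base using (+_)
open import Data.Nat.Base as ℕ using (ℕ; _≥_; _∸_)
open import Data.Product.Base using (∃-syntax; _,_)
open import Data.Rational.Base as ℚ using (1ℚ; _/_; _-_)

-- From the inequality in ℕ to the inequality between radicals.

module RationalBound where
  open Sieve using (E≡count; count)
  open RadicalOrder
  open NaturalBound
  open import Data.Fin.Base using (Fin; zero; suc)
  open import Data.Nat.Base using (zero; suc)
  import Data.Nat.Properties as ℕ
  open import Data.Rational.Base using (ℚ; Positive; _≤_)
  import Data.Rational.Properties as ℚ
  import Algebra.Definitions.RawSemiring ℚ.+-*-rawSemiring as ℚPow
  open import Algebra.Bundles using (CommutativeRing)
  open import Algebra.Properties.CommutativeSemiring.Exp (CommutativeRing.commutativeSemiring ℚ.+-*-commutativeRing) using (^-distrib-*)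
  open import Algebra.Properties.CommutativeSemigroup (CommutativeRing.*-commutativeSemigroup ℚ.+-*-commutativeRing) using (interchange)
  open import Function.Base using (_∘_)
  open import Relation.Binary.PropositionalEquality

  -- Used with `m = 4`, the denominator of each ((qᵢ - 1) / 2)²; this is where the factor 4^ω
  -- arises.
  ∏ℚ-*-ι : ∀ {n} (s : Fin n → ℚ) m (S : Fin n → ℕ) → (∀ i → s i ℚ.* ι m ≡ ι (S i)) →
           ∏ℚ s ℚ.* ι (m ℕ.^ n) ≡ ι (∏ℕ S)
  ∏ℚ-*-ι {zero}  s m S sm≡S = refl
  ∏ℚ-*-ι {suc n} s m S sm≡S = begin
    s zero ℚ.* ∏ℚ (s ∘ suc) ℚ.* ι (m ℕ.* m ℕ.^ n)              ≡⟨ cong (s zero ℚ.* ∏ℚ (s ∘ suc) ℚ.*_) (ι-* m (m ℕ.^ n)) ⟩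
    s zero ℚ.* ∏ℚ (s ∘ suc) ℚ.* (ι m ℚ.* ι (m ℕ.^ n))          ≡⟨ interchange (s zero) (∏ℚ (s ∘ suc)) (ι m) (ι (m ℕ.^ n)) ⟩
    s zero ℚ.* ι m ℚ.* (∏ℚ (s ∘ suc) ℚ.* ι (m ℕ.^ n))          ≡⟨ cong₂ ℚ._*_ (sm≡S zero) (∏ℚ-*-ι (s ∘ suc) m (S ∘ suc) (sm≡S ∘ suc)) ⟩
    ι (S zero) ℚ.* ι (∏ℕ (S ∘ suc))                            ≡⟨ ι-* (S zero) (∏ℕ (S ∘ suc)) ⟨
    ι (S zero ℕ.* ∏ℕ (S ∘ suc))                                ∎
    where open ≡-Reasoning

  ¼ : ℚ
  ¼ = + 1 / 4

  ¼^k*ι[4^k]≡1 : ∀ k → ¼ ℚPow.^ k ℚ.* ι (4 ℕ.^ k) ≡ 1ℚ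
  ¼^k*ι[4^k]≡1 k = trans (cong (¼ ℚPow.^ k ℚ.*_) (ι-^ 4 k)) (trans (sym (^-distrib-* ¼ (ι 4) k)) (1^ k))

  -- The exponent remains a variable throughout this part, so the powers of `¼` and 4 stay symbolic.
  constant : ℕ → Radical
  constant k = _√_ 1 (¼ ℚPow.^ k) {{_}} {{^-pos ¼ k}}

  module _ (k : ℕ) {c : ℕ} (c≥3 : c ≥ 3) (f : Factorisation c) where
    open Factorisation f

    private
      s : Fin ω → ℚ
      s i = ι (q i) ℚPow.^ (2 ℕ.* a i ∸ 1) ℚ.* (+ (q i ∸ 1) / 2) ℚPow.^ 2

      S : Fin ω → ℕ
      S i = q i ℕ.^ (2 ℕ.* a i ∸ 1) ℕ.* (q i ∸ 1) ℕ.^ 2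

      ιq>0 : ∀ i → Positive (ι (q i))
      ιq>0 i = /-pos (q i) 1 {{q≢0 {i}}}

      t>0 : ∀ i → Positive (+ (q i ∸ 1) / 2)
      t>0 i = /-pos (q i ∸ 1) 2 {{q∸1≢0 {i}}}

      q^>0 : ∀ i → Positive (ι (q i) ℚPow.^ (2 ℕ.* a i ∸ 1))
      q^>0 i = ^-pos (ι (q i)) {{ιq>0 i}} (2 ℕ.* a i ∸ 1)

      t²>0 : ∀ i → Positive ((+ (q i ∸ 1) / 2) ℚPow.^ 2)
      t²>0 i = ^-pos (+ (q i ∸ 1) / 2) {{t>0 i}} 2

      s>0 : ∀ i → Positive (s i)
      s>0 i = ℚ.pos*pos⇒pos (ι (q i) ℚPow.^ (2 ℕ.* a i ∸ 1)) {{q^>0 i}} ((+ (q i ∸ 1) / 2) ℚPow.^ 2) {{t²>0 i}}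

    exponent≤ : ∀ i → + (2 ℕ.* a i) / 1 - 1ℚ - (+ 2 / φ c) ℚ.* (E (q i) / 1) ≤ ι (2 ℕ.* a i ∸ 1)
    exponent≤ i = subst₂ (λ x z → x - (+ 2 / φ c) ℚ.* (z / 1) ≤ ι (2 ℕ.* a i ∸ 1))
      (sym (ι-∸1 (2 ℕ.* a i) (ℕ.≤-trans (a≥1 i) (ℕ.m≤n*m (a i) 2)))) (sym (E≡count c≥3 f i))
      (p-nonNeg≤p (ι (2 ℕ.* a i ∸ 1)) _ {{ℚ.nonNeg*nonNeg⇒nonNeg (+ 2 / φ c) {{ℚ.normalize-nonNeg 2 (φ c)}} (ι N) {{ι-nonNeg N}}}})
      where N = count q ((c ℕ./ q i) {{q≢0 {i}}})

    factor≼ : ∀ i → nat (q i) ^ (+ (2 ℕ.* a i) / 1 - 1ℚ - (+ 2 / φ c) ℚ.* (E (q i) / 1)) * frac (q i ∸ 1) 2 ^ (+ 2 / 1) ≼ s i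
    factor≼ i = ≼-* (nat (q i) ^ e) (frac (q i ∸ 1) 2 ^ (+ 2 / 1)) {{q^>0 i}} {{t²>0 i}}
      (nat-^-≼ (q i) e (2 ℕ.* a i ∸ 1) (exponent≤ i))
      -- The second factor is rational, with index 1, so its bound is an equality.
      (ℚ.≤-reflexive (sym (ℚ.*-identityʳ _)))
      where e = + (2 ℕ.* a i) / 1 - 1ℚ - (+ 2 / φ c) ℚ.* (E (q i) / 1)

    s*4≡S : ∀ i → s i ℚ.* ι 4 ≡ ι (S i)
    s*4≡S i = begin
      q^ ℚ.* t ℚPow.^ 2 ℚ.* ι 4               ≡⟨ ℚ.*-assoc q^ (t ℚPow.^ 2) (ι 4) ⟩
      q^ ℚ.* (t ℚPow.^ 2 ℚ.* ι 2 ℚPow.^ 2)    ≡⟨ cong (q^ ℚ.*_) (^-distrib-* t (ι 2) 2) ⟨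
      q^ ℚ.* (t ℚ.* ι 2) ℚPow.^ 2             ≡⟨ cong₂ (λ x y → x ℚ.* y ℚPow.^ 2) (sym (ι-^ (q i) (2 ℕ.* a i ∸ 1))) (/-*-ι (q i ∸ 1) 2) ⟩
      ι (q i ℕ.^ (2 ℕ.* a i ∸ 1)) ℚ.* ι (q i ∸ 1) ℚPow.^ 2 ≡⟨ cong (ι (q i ℕ.^ (2 ℕ.* a i ∸ 1)) ℚ.*_) (ι-^ (q i ∸ 1) 2) ⟨
      ι (q i ℕ.^ (2 ℕ.* a i ∸ 1)) ℚ.* ι ((q i ∸ 1) ℕ.^ 2)  ≡⟨ ι-* (q i ℕ.^ (2 ℕ.* a i ∸ 1)) ((q i ∸ 1) ℕ.^ 2) ⟨
      ι (S i)                                 ∎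
      where
      open ≡-Reasoning
      q^ = ι (q i) ℚPow.^ (2 ℕ.* a i ∸ 1)
      t = + (q i ∸ 1) / 2

    -- Multiplication by 4^((ω + k) φ) clears every denominator: 4^k comes from the constant and 4^ω
    -- from the halves. What remains is the hypothesis, embedded in ℚ.
    bound : ∏ℕ S ℕ.^ φ c ℕ.< G c ℕ.^ 2 ℕ.* (4 ℕ.^ (ω ℕ.+ k)) ℕ.^ φ c →
      nat (G c) {{G≢0 c}} ^ (+ 2 / φ c) >
        constant k * ∏ (λ i →
          nat (q i) ^ (+ (2 ℕ.* a i) / 1 - 1ℚ - (+ 2 / φ c) ℚ.* (E (q i) / 1))
          * frac (q i ∸ 1) 2 ^ (+ 2 / 1))
    bound S^φ< = ≼⇒< (constant k * ∏ factor) (G c) {{G≢0 c}} 2 (φ c) (K ℚ.* ∏ℚ s) {{x>0}}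
      (≼-* (constant k) (∏ factor) {K} {∏ℚ s} {{^-pos ¼ k}} {{∏ℚ-pos s s>0}} (ℚ.≤-reflexive (sym (ℚ.*-identityʳ K))) (≼-∏ factor s s>0 factor≼))
      (ℚ.*-cancelʳ-<-nonNeg (ι X) {{ι-nonNeg X}} (subst₂ ℚ._<_ (sym lhs) rhs (ι-mono-< S^φ<)))
      where
      open ≡-Reasoning
      K = ¼ ℚPow.^ k
      factor = λ i → nat (q i) ^ (+ (2 ℕ.* a i) / 1 - 1ℚ - (+ 2 / φ c) ℚ.* (E (q i) / 1)) * frac (q i ∸ 1) 2 ^ (+ 2 / 1)
      X = (4 ℕ.^ (ω ℕ.+ k)) ℕ.^ φ c
      x>0 : Positive (K ℚ.* ∏ℚ s)
      x>0 = ℚ.pos*pos⇒pos K {{^-pos ¼ k}} (∏ℚ s) {{∏ℚ-pos s s>0}}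
      base : K ℚ.* ∏ℚ s ℚ.* ι (4 ℕ.^ (ω ℕ.+ k)) ≡ ι (∏ℕ S)
      base = begin
        K ℚ.* ∏ℚ s ℚ.* ι (4 ℕ.^ (ω ℕ.+ k))                 ≡⟨ cong (K ℚ.* ∏ℚ s ℚ.*_) (trans (cong ι (trans (ℕ.^-distribˡ-+-* 4 ω k) (ℕ.*-comm (4 ℕ.^ ω) _))) (ι-* (4 ℕ.^ k) (4 ℕ.^ ω))) ⟩
        K ℚ.* ∏ℚ s ℚ.* (ι (4 ℕ.^ k) ℚ.* ι (4 ℕ.^ ω))       ≡⟨ interchange K (∏ℚ s) (ι (4 ℕ.^ k)) (ι (4 ℕ.^ ω)) ⟩
        K ℚ.* ι (4 ℕ.^ k) ℚ.* (∏ℚ s ℚ.* ι (4 ℕ.^ ω))       ≡⟨ cong₂ ℚ._*_ (¼^k*ι[4^k]≡1 k) (∏ℚ-*-ι s 4 S s*4≡S) ⟩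
        1ℚ ℚ.* ι (∏ℕ S)                                    ≡⟨ ℚ.*-identityˡ _ ⟩
        ι (∏ℕ S)                                           ∎
      lhs : (K ℚ.* ∏ℚ s) ℚPow.^ φ c ℚ.* ι X ≡ ι (∏ℕ S ℕ.^ φ c)
      lhs = begin
        (K ℚ.* ∏ℚ s) ℚPow.^ φ c ℚ.* ι X                                    ≡⟨ cong ((K ℚ.* ∏ℚ s) ℚPow.^ φ c ℚ.*_) (ι-^ (4 ℕ.^ (ω ℕ.+ k)) (φ c)) ⟩
        (K ℚ.* ∏ℚ s) ℚPow.^ φ c ℚ.* ι (4 ℕ.^ (ω ℕ.+ k)) ℚPow.^ φ c         ≡⟨ ^-distrib-* (K ℚ.* ∏ℚ s) _ (φ c) ⟨
        (K ℚ.* ∏ℚ s ℚ.* ι (4 ℕ.^ (ω ℕ.+ k))) ℚPow.^ φ c                    ≡⟨ cong (ℚPow._^ φ c) base ⟩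
        ι (∏ℕ S) ℚPow.^ φ c                                                ≡⟨ ι-^ (∏ℕ S) (φ c) ⟨
        ι (∏ℕ S ℕ.^ φ c)                                                   ∎
      rhs : ι (G c ℕ.^ 2 ℕ.* X) ≡ ι (G c) ℚPow.^ 2 ℚ.* ι X
      rhs = trans (ι-* (G c ℕ.^ 2) X) (cong (ℚ._* ι X) (ι-^ (G c) 2))

theorem2 : ∃[ k₄ ] ((c : ℕ) → c ≥ 3 → (f : Factorisation c) →
    let open Factorisation f in
    nat (G c) {{G≢0 c}} ^ (+ 2 / φ c) >
    k₄ * ∏ (λ i →
    nat (q i) ^ (+ (2 ℕ.* a i) / 1 - 1ℚ - (+ 2 / φ c) ℚ.* (E (q i) / 1))
    * frac (q i ∸ 1) 2 ^ (+ 2 / 1)))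
-- k₄ = 4⁻²⁵⁹: 256 comes from 8c ≤ φ (ω + 256), 2 from (φ / 4)^φ squared, and 1 makes the inequality strict.
theorem2 = RationalBound.constant 259 , λ c c≥3 f →
  RationalBound.bound 259 c≥3 f (NaturalBound.∏^φ<G² c≥3 f)
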